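{- Let $N$ be a positive integer. The noncommutative Schur function $\mathfrak{J}_\lambda(\mathbf{u})$ is a positive sum of monomials in $\mathcal{U}/I_{\mathrm{KR}}^{\mathrm{st}}$ when $\lambda$ is a hook shape $(a,1^b)$, or of the form $(a,2)$ (with $a\ge 2$), or of the form $(2,2,1^a)$ (with $a\ge 0$).
   Context: $\mathcal{U}=\mathbb{Z}\langle u_1,\dots,u_N\rangle$ is the free associative algebra in noncommuting variables; we write the letter $a$ for $u_a$, so monomials are words in the alphabet $\{1,\dots,N\}$. $I_{\mathrm{KR}}^{\mathrm{st}}$ is the two-sided ideal of $\mathcal{U}$ generated by $b(ac-ca)-(ac-ca)b$ for all letters $a<b<c$, and by all words having a repeated letter. For $d>0$, $e_d(\mathbf{u})=\sum_{N\ge i_1>i_2>\cdots>i_d\ge 1}u_{i_1}\cdots u_{i_d}$, $e_0(\mathbf{u})=1$, $e_d(\mathbf{u})=0$ for $d<0$. For a partition $\lambda$ with conjugate $\lambda'=(\lambda'_1,\dots,\lambda'_t)$ ($t=\lambda_1$), $\mathfrak{J}_\lambda(\mathbf{u})=\sum_{\pi\in S_t}\mathrm{sgn}(\pi)\,e_{\lambda'_1+\pi(1)-1}(\mathbf{u})\cdots e_{\lambda'_t+\pi(t)-t}(\mathbf{u})\in\mathcal{U}$. An element $z$ is a positive sum of monomials in $\mathcal{U}/I$ if $z\equiv \sum_k c_k w_k \pmod I$ for some words $w_k$ and integers $c_k\ge 0$. -}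

module Defs where

open import Data.Nat as ℕ using (ℕ; zero; suc; _⊔_; _≤?_; _<?_)
open import Data.Integer as ℤ using (ℤ; +_; -[1+_]; _*_; _-_; _+_; -_; 0ℤ; 1ℤ)
open import Data.Fin as Fin using (Fin; fromℕ; inject₁)
open import Data.List using (List; []; _∷_; [_]; _++_; map; foldr; concatMap; upTo; length; filter)
open import Data.List.Properties using (≡-dec)
open import Data.List.Relation.Unary.All using (All)
open import Data.List.Relation.Unary.Unique.Propositional using (Unique)
open import Data.Product using (Σ; _×_; _,_; Σ-syntax)
open import Relation.Nullary using (¬_; does)
open import Relation.Binary.PropositionalEquality using (_≡_)
open import Data.Bool using (if_then_else_)

-- The free associative ℤ-algebra  U = ℤ⟨u_1,…,u_N⟩.
-- A letter a : Fin N stands for the variable u_{toℕ a + 1}; the order on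
-- letters is the order of Fin N (i.e. of the indices).

Word : ℕ → Set
Word N = List (Fin N)

-- An element of U is represented by a finite formal ℤ-linear combination
-- of words; two representations are equal in U iff all coefficients agree.
Poly : ℕ → Set
Poly N = List (ℤ × Word N)

module _ {N : ℕ} where

  coeff : Poly N → Word N → ℤ
  coeff [] w = 0ℤ
  coeff ((c , v) ∷ p) w =
    (if does (≡-dec Fin._≟_ v w) then c else 0ℤ) + coeff p w

  _≈U_ : Poly N → Poly N → Set
  p ≈U q = ∀ w → coeff p w ≡ coeff q w

  mono : Word N → Poly N
  mono w = [ (1ℤ , w) ]

  zeroU : Poly N
  zeroU = []

  oneU : Poly N
  oneU = mono []

  _+U_ : Poly N → Poly N → Poly N
  p +U q = p ++ q

  scale : ℤ → Poly N → Poly N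
  scale s = map (λ { (c , w) → (s * c , w) })

  _-U_ : Poly N → Poly N → Poly N
  p -U q = p ++ scale (- 1ℤ) q

  _*U_ : Poly N → Poly N → Poly N
  p *U q = concatMap (λ { (c , v) → map (λ { (d , w) → (c * d , v ++ w) }) q }) p

  data KRGen : Poly N → Set where
    -- b(ac − ca) − (ac − ca)b  for letters a < b < c
    comm : (a b c : Fin N) → a Fin.< b → b Fin.< c →
           KRGen ((mono (b ∷ a ∷ c ∷ []) -U mono (b ∷ c ∷ a ∷ []))
                  -U (mono (a ∷ c ∷ b ∷ []) -U mono (c ∷ a ∷ b ∷ [])))
    rep  : (w : Word N) → ¬ Unique w → KRGen (mono w)

  -- The two-sided ideal generated by KRGen: since U is spanned over ℤ by
  -- words, its elements are exactly the finite sums  Σ c_k · x_k g_k y_k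
  -- with c_k ∈ ℤ, words x_k, y_k and generators g_k.
  combination : List (ℤ × Word N × Poly N × Word N) → Poly N
  combination [] = zeroU
  combination ((c , x , g , y) ∷ l) =
    scale c ((mono x *U g) *U mono y) +U combination l

  _∈I-KR : Poly N → Set
  z ∈I-KR = Σ[ l ∈ List (ℤ × Word N × Poly N × Word N) ]
              All (λ { (_ , _ , g , _) → KRGen g }) l × (z ≈U combination l)

  PositiveModKR : Poly N → Set
  PositiveModKR z = Σ[ l ∈ List (ℕ × Word N) ]
    ((z -U map (λ { (c , w) → (+ c , w) }) l) ∈I-KR)

decWords : (n d : ℕ) → List (Word n)
decWords n zero = [ [] ]
decWords zero (suc d) = []
decWords (suc n) (suc d) =
  map (map inject₁) (decWords n (suc d)) ++
  map (λ w → fromℕ n ∷ map inject₁ w) (decWords n d)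

e : (N : ℕ) → ℤ → Poly N
e N (+ d) = map (λ w → (1ℤ , w)) (decWords N d)
e N -[1+ _ ] = zeroU

-- Partitions (weakly decreasing lists of positive naturals), conjugates,
-- permutations and signs.

firstPart : List ℕ → ℕ
firstPart = foldr _⊔_ 0

conj : List ℕ → List ℕ
conj λ′ = map (λ j → length (filter (λ x → suc j ≤? x) λ′)) (upTo (firstPart λ′))

insertions : ℕ → List ℕ → List (List ℕ)
insertions x [] = [ [ x ] ]
insertions x (y ∷ ys) = (x ∷ y ∷ ys) ∷ map (y ∷_) (insertions x ys)

perms : List ℕ → List (List ℕ)
perms [] = [ [] ]
perms (x ∷ xs) = concatMap (insertions x) (perms xs)

inversions : List ℕ → ℕ
inversions [] = 0
inversions (x ∷ xs) = length (filter (λ y → y <? x) xs) ℕ.+ inversions xs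

sgnOf : ℕ → ℤ
sgnOf zero = 1ℤ
sgnOf (suc k) = - sgnOf k

-- Π_{i} e_{λ'_i + π(i) − i}, positions counted from i (0-based shift is
-- harmless since π(i) and i are shifted alike)
eProd : (N : ℕ) → ℕ → List ℕ → List ℕ → Poly N
eProd N i (l ∷ ls) (p ∷ ps) = e N ((+ l + + p) - + i) *U eProd N (suc i) ls ps
eProd N i _ _ = oneU

𝔍 : (N : ℕ) → List ℕ → Poly N
𝔍 N λ′ = foldr _+U_ zeroU
  (map (λ π → scale (sgnOf (inversions π)) (eProd N 0 (conj λ′) π))
       (perms (upTo (length (conj λ′)))))

{-# OPTIONS --safe #-}
module Submission where

open import Defs
open import Algebra.Bundles using (Ring)
open import Data.Bool using (Bool; true; false; if_then_else_; _∧_; not)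
open import Data.Bool.Properties using (T-≡; ¬-not)
open import Data.Fin as Fin using (Fin; fromℕ; inject₁; toℕ)
import Data.Fin.Properties as Fin
open import Data.Integer as ℤ using (ℤ; -[1+_]; 0ℤ; 1ℤ) renaming (+_ to pos)
import Data.Integer.Properties as ℤ
open import Data.Integer.Solver using (module +-*-Solver)
open import Data.List using (List; []; _∷_; [_]; _++_; map; foldr; concatMap; replicate; upTo; length; filter; applyUpTo)
import Data.List.Properties as List
open import Data.List.Relation.Unary.All as All using (All; []; _∷_)
import Data.List.Relation.Unary.All.Properties as All
open import Data.List.Relation.Unary.Unique.Propositional using (Unique; _∷_)
open import Data.Nat as ℕ using (ℕ; zero; suc; _≤_; s≤s; z≤n)
import Data.Nat.Properties as ℕ
open import Data.Product using (Σ-syntax; _×_; _,_; proj₁; proj₂)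
import Level
open import Function using (_∘_; flip; Equivalence)
open import Relation.Binary.Definitions using (Tri; tri<; tri≈; tri>)
import Relation.Binary.Construct.Flip.EqAndOrd as Flip
open import Relation.Binary.Structures using (IsStrictTotalOrder)
open import Relation.Binary.PropositionalEquality as ≡ using (_≡_)
open import Relation.Nullary using (¬_; contradiction; does)

-- Modulo words with repeated letters, e_{l+1} times the sum of increasing words of length m + 1
-- is the sum of the words  i₀ > ⋯ > i_l < ⋯ < i_{l+m+1}  plus that of the words
-- i₀ > ⋯ > i_{l+1} < ⋯ < i_{l+m+1}.  Expanding the Jacobi–Trudi determinant along its first
-- column gives the same recursion, so a hook is the sum W l m of the words
-- i₀ > ⋯ > i_l < ⋯ < i_{l+m}.
--
-- For (2,2,1^a) and (a,2) the expansion leaves  e_k e_2 − e_{k+1} e_1  and, because e_1 commutes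
-- with every e_d modulo the ideal,  e_2 W 1 m − e_1 W 2 m.  The two terms of such a difference
-- impose different conditions on only three consecutive letters.  Fixing the rest of the word
-- and the set a < b < c of these letters, the relation  bac + cab ≡ bca + acb  removes all
-- negative terms.

-- The rows of the determinant are multiplied in a fixed order, so expansion along a column cannot
-- pull an entry out in front: an entry of the second row stays between the entry of the first row
-- and the remaining rows. `detWith` carries such a trapped factor. For hooks it is e_0 = 1; for the
-- other two families it is e_1, and for (a,2) centrality is what frees it.
--
-- In the two positive differences the rest of the word meets the three varying letters only through
-- a one-sided bound on one end letter: the preceding letter of a decreasing word bounds the first
-- of them from above, or the first letter of an increasing tail bounds the last of them from below.
-- Such a bound is a condition `P` closed downwards for the order or for its reverse, so a single
-- statement about three letters, `∑³-excess`, serves both.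
--
-- The combinatorics takes place in any ring with elements satisfying `KR`. Differences are stated
-- as x ≈ y + g with g a sum of words, so positivity is never read off from a subtraction.

module Words {c ℓ} (R : Ring c ℓ) where
  open Ring R hiding (zero)
  open import Algebra.Properties.Ring R
  import Algebra.Properties.Semiring.Sum semiring as Sum
  open import Algebra.Solver.CommutativeMonoid +-commutativeMonoid using (solve; _⊕_; _⊜_; id)
  open import Relation.Binary.Reasoning.Setoid setoid

  -- Opacity lets Agda infer the summand from a sum, and the letters from a comparison.
  opaque
    ∑ : ∀ {n} → (Fin n → Carrier) → Carrier
    ∑ f = Sum.sum f

    ∑-empty : (f : Fin 0 → Carrier) → ∑ f ≈ 0#
    ∑-empty f = refl

    ∑-suc : ∀ {n} (f : Fin (suc n) → Carrier) → ∑ f ≈ f Fin.zero + ∑ (f ∘ Fin.suc)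
    ∑-suc f = refl

    ∑-cong : ∀ {n} {f g : Fin n → Carrier} → (∀ i → f i ≈ g i) → ∑ f ≈ ∑ g
    ∑-cong = Sum.sum-cong-≋

    ∑-zero : ∀ {n} → ∑ {n} (λ _ → 0#) ≈ 0#
    ∑-zero {n} = Sum.sum-replicate-zero n

    ∑-init-last : ∀ {n} (f : Fin (suc n) → Carrier) → ∑ f ≈ ∑ (f ∘ inject₁) + f (fromℕ n)
    ∑-init-last = Sum.sum-init-last

    ∑-+ : ∀ {n} (f g : Fin n → Carrier) → ∑ (λ i → f i + g i) ≈ ∑ f + ∑ g
    ∑-+ = Sum.∑-distrib-+

    ∑-comm : ∀ {m n} (f : Fin m → Fin n → Carrier) → ∑ (λ i → ∑ (λ j → f i j)) ≈ ∑ (λ j → ∑ (λ i → f i j))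
    ∑-comm = Sum.∑-comm

    *-∑ : ∀ {n} x (f : Fin n → Carrier) → x * ∑ f ≈ ∑ (λ i → x * f i)
    *-∑ = Sum.*-distribˡ-sum

    ∑-* : ∀ {n} (f : Fin n → Carrier) x → ∑ f * x ≈ ∑ (λ i → f i * x)
    ∑-* f x = Sum.*-distribʳ-sum x f

    _<ᵇ_ : ∀ {n} → Fin n → Fin n → Bool
    i <ᵇ j = toℕ i ℕ.<ᵇ toℕ j

    <⇒<ᵇ≡true : ∀ {n} {i j : Fin n} → i Fin.< j → i <ᵇ j ≡ true
    <⇒<ᵇ≡true i<j = Equivalence.to T-≡ (ℕ.<⇒<ᵇ i<j)

    <ᵇ≡true⇒< : ∀ {n} {i j : Fin n} → i <ᵇ j ≡ true → i Fin.< j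
    <ᵇ≡true⇒< {i = i} {j} eq = ℕ.<ᵇ⇒< (toℕ i) (toℕ j) (Equivalence.from T-≡ eq)

  ≮⇒<ᵇ≡false : ∀ {n} {i j : Fin n} → ¬ i Fin.< j → i <ᵇ j ≡ false
  ≮⇒<ᵇ≡false {i = i} {j} i≮j with i <ᵇ j in eq
  ... | false = ≡.refl
  ... | true  = contradiction (<ᵇ≡true⇒< eq) i≮j

  <ᵇ-irrefl : ∀ {n} (i : Fin n) → i <ᵇ i ≡ false
  <ᵇ-irrefl i = ≮⇒<ᵇ≡false (ℕ.n≮n (toℕ i))

  -- Summands restricted by a Boolean condition

  guard : Bool → Carrier → Carrier
  guard true  x = x
  guard false x = 0#

  guard-cong : ∀ b {x y} → x ≈ y → guard b x ≈ guard b y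
  guard-cong true  x≈y = x≈y
  guard-cong false _   = refl

  guard-0 : ∀ b → guard b 0# ≈ 0#
  guard-0 true  = refl
  guard-0 false = refl

  guard-+ : ∀ b x y → guard b (x + y) ≈ guard b x + guard b y
  guard-+ true  x y = refl
  guard-+ false x y = sym (+-identityˡ 0#)

  *-guard : ∀ b x y → x * guard b y ≈ guard b (x * y)
  *-guard true  x y = refl
  *-guard false x y = zeroʳ x

  guard-* : ∀ b x y → guard b x * y ≈ guard b (x * y)
  guard-* true  x y = refl
  guard-* false x y = zeroˡ y

  guard-∑ : ∀ b {n} (f : Fin n → Carrier) → guard b (∑ f) ≈ ∑ (λ i → guard b (f i))
  guard-∑ true  f = refl
  guard-∑ false f = sym ∑-zero

  guard-comm : ∀ a b x → guard a (guard b x) ≈ guard b (guard a x)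
  guard-comm true  b x = refl
  guard-comm false b x = sym (guard-0 b)

  -- Commutators

  ⁅_,_⁆ : Carrier → Carrier → Carrier
  ⁅ x , y ⁆ = x * y - y * x

  interchange : ∀ a b c d → (a + b) + (c + d) ≈ (a + c) + (b + d)
  interchange = solve 4 (λ a b c d → (a ⊕ b) ⊕ (c ⊕ d) ⊜ (a ⊕ c) ⊕ (b ⊕ d)) refl

  -‿interchange : ∀ a b c d → (a + b) - (c + d) ≈ (a - c) + (b - d)
  -‿interchange a b c d = trans (+-congˡ (sym (-‿+-comm c d))) (interchange a b (- c) (- d))

  ⁅⁆-cong : ∀ {x x′ y y′} → x ≈ x′ → y ≈ y′ → ⁅ x , y ⁆ ≈ ⁅ x′ , y′ ⁆
  ⁅⁆-cong p q = +-cong (*-cong p q) (-‿cong (*-cong q p))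

  ⁅⁆-distribʳ-+ : ∀ z x y → ⁅ z , x + y ⁆ ≈ ⁅ z , x ⁆ + ⁅ z , y ⁆
  ⁅⁆-distribʳ-+ z x y = trans (+-cong (distribˡ z x y) (-‿cong (distribʳ z x y))) (-‿interchange _ _ _ _)

  ⁅⁆-distribˡ-+ : ∀ z x y → ⁅ x + y , z ⁆ ≈ ⁅ x , z ⁆ + ⁅ y , z ⁆
  ⁅⁆-distribˡ-+ z x y = trans (+-cong (distribʳ z x y) (-‿cong (distribˡ z x y))) (-‿interchange _ _ _ _)

  ⁅⁆-leibniz : ∀ z x y → ⁅ z , x * y ⁆ ≈ ⁅ z , x ⁆ * y + x * ⁅ z , y ⁆
  ⁅⁆-leibniz z x y = sym (begin
    ⁅ z , x ⁆ * y + x * ⁅ z , y ⁆                              ≈⟨ +-cong ([y-z]x≈yx-zx _ _ _) (x[y-z]≈xy-xz _ _ _) ⟩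
    (z * x * y - x * z * y) + (x * (z * y) - x * (y * z))      ≈⟨ +-cong (+-congʳ (*-assoc z x y)) (+-cong (sym (*-assoc x z y)) (-‿cong (sym (*-assoc x y z)))) ⟩
    (z * (x * y) - x * z * y) + (x * z * y - x * y * z)        ≈⟨ +-assoc _ _ _ ⟩
    z * (x * y) + (- (x * z * y) + (x * z * y - x * y * z))    ≈⟨ +-congˡ (sym (+-assoc _ _ _)) ⟩
    z * (x * y) + ((- (x * z * y) + x * z * y) - x * y * z)    ≈⟨ +-congˡ (trans (+-congʳ (-‿inverseˡ _)) (+-identityˡ _)) ⟩
    ⁅ z , x * y ⁆ ∎)

  ⁅⁆-self : ∀ x → ⁅ x , x ⁆ ≈ 0#
  ⁅⁆-self x = -‿inverseʳ (x * x)

  ⁅⁆-anti : ∀ x y → ⁅ x , y ⁆ + ⁅ y , x ⁆ ≈ 0#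
  ⁅⁆-anti x y = begin
    ⁅ x , y ⁆ + ⁅ y , x ⁆                 ≈⟨ -‿interchange _ _ _ _ ⟨
    (x * y + y * x) - (y * x + x * y)     ≈⟨ +-congˡ (-‿cong (+-comm _ _)) ⟩
    (x * y + y * x) - (x * y + y * x)     ≈⟨ -‿inverseʳ _ ⟩
    0#                                    ∎

  ⁅⁆-1 : ∀ x → ⁅ x , 1# ⁆ ≈ 0#
  ⁅⁆-1 x = trans (+-cong (*-identityʳ x) (-‿cong (*-identityˡ x))) (-‿inverseʳ x)

  ⁅⁆-0 : ∀ x → ⁅ x , 0# ⁆ ≈ 0#
  ⁅⁆-0 x = trans (+-cong (zeroʳ x) (-‿cong (zeroˡ x))) (-‿inverseʳ 0#)

  ⁅⁆≈0⇒comm : ∀ {x y} → ⁅ x , y ⁆ ≈ 0# → x * y ≈ y * x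
  ⁅⁆≈0⇒comm {x} {y} = x∙y⁻¹≈ε⇒x≈y (x * y) (y * x)

  -- Elementary symmetric functions, recursively in the largest letter

  E : ∀ n → (Fin n → Carrier) → ℕ → Carrier
  E n       u zero    = 1#
  E zero    u (suc d) = 0#
  E (suc n) u (suc d) = E n (u ∘ inject₁) (suc d) + u (fromℕ n) * E n (u ∘ inject₁) d

  -- The relations of the ideal, for elements of any ring. In `repeat` the middle factor is an
  -- arbitrary ring element: by linearity this amounts to the vanishing of words with a repeated
  -- letter, and it applies directly when the middle is a whole sum such as `E n u d`.
  record KR {n} (u : Fin n → Carrier) : Set (c Level.⊔ ℓ) where
    field
      bracket : ∀ {i j k} → i Fin.< j → j Fin.< k → u j * ⁅ u i , u k ⁆ ≈ ⁅ u i , u k ⁆ * u j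
      repeat  : ∀ i x → u i * (x * u i) ≈ 0#

    square : ∀ i → u i * u i ≈ 0#
    square i = trans (*-congˡ (sym (*-identityˡ (u i)))) (repeat i 1#)

  open KR

  inject₁-mono : ∀ {n} {i j : Fin n} → i Fin.< j → inject₁ i Fin.< inject₁ j
  inject₁-mono {i = i} {j} = ≡.subst₂ ℕ._<_ (≡.sym (Fin.toℕ-inject₁ i)) (≡.sym (Fin.toℕ-inject₁ j))

  inject₁<fromℕ : ∀ {n} (i : Fin n) → inject₁ i Fin.< fromℕ n
  inject₁<fromℕ {n} i = ≡.subst (toℕ (inject₁ i) ℕ.<_) (≡.sym (Fin.toℕ-fromℕ n)) (Fin.inject₁ℕ< i)

  KR-restrict : ∀ {n} {u : Fin (suc n) → Carrier} → KR u → KR (u ∘ inject₁)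
  KR-restrict kr .bracket i<j j<k = bracket kr (inject₁-mono i<j) (inject₁-mono j<k)
  KR-restrict kr .repeat i = repeat kr (inject₁ i)

  -- Commutation of e_1 with every e_d

  E₁-step : ∀ n (u : Fin (suc n) → Carrier) → E (suc n) u 1 ≈ E n (u ∘ inject₁) 1 + u (fromℕ n)
  E₁-step n u = +-congˡ (*-identityʳ _)

  ⁅⁆-E₁-step : ∀ n (u : Fin (suc n) → Carrier) z →
    ⁅ z , E (suc n) u 1 ⁆ ≈ ⁅ z , E n (u ∘ inject₁) 1 ⁆ + ⁅ z , u (fromℕ n) ⁆
  ⁅⁆-E₁-step n u z = trans (⁅⁆-cong refl (E₁-step n u)) (⁅⁆-distribʳ-+ z _ _)

  -- Lifts the bracket relation from single letters to their sum; `⁅⁆-E` uses it to move a letter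
  -- past the bracket of z with e_1 of the letters below.
  E₁-bracket-commutes : ∀ n (u : Fin n → Carrier) z m →
    (∀ i → m * ⁅ z , u i ⁆ ≈ ⁅ z , u i ⁆ * m) →
    m * ⁅ z , E n u 1 ⁆ ≈ ⁅ z , E n u 1 ⁆ * m
  E₁-bracket-commutes zero u z m h = begin
    m * ⁅ z , 0# ⁆ ≈⟨ *-congˡ (⁅⁆-0 z) ⟩
    m * 0#         ≈⟨ trans (zeroʳ m) (sym (zeroˡ m)) ⟩
    0# * m         ≈⟨ *-congʳ (⁅⁆-0 z) ⟨
    ⁅ z , 0# ⁆ * m ∎
  E₁-bracket-commutes (suc n) u z m h = begin
    m * ⁅ z , E (suc n) u 1 ⁆                                     ≈⟨ *-congˡ (⁅⁆-E₁-step n u z) ⟩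
    m * (⁅ z , E n (u ∘ inject₁) 1 ⁆ + ⁅ z , u (fromℕ n) ⁆)       ≈⟨ distribˡ m _ _ ⟩
    m * ⁅ z , E n (u ∘ inject₁) 1 ⁆ + m * ⁅ z , u (fromℕ n) ⁆     ≈⟨ +-cong (E₁-bracket-commutes n (u ∘ inject₁) z m (h ∘ inject₁)) (h (fromℕ n)) ⟩
    ⁅ z , E n (u ∘ inject₁) 1 ⁆ * m + ⁅ z , u (fromℕ n) ⁆ * m     ≈⟨ distribʳ m _ _ ⟨
    (⁅ z , E n (u ∘ inject₁) 1 ⁆ + ⁅ z , u (fromℕ n) ⁆) * m       ≈⟨ *-congʳ (⁅⁆-E₁-step n u z) ⟨
    ⁅ z , E (suc n) u 1 ⁆ * m                                     ∎

  -- z plays the role of a letter larger than all those of u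
  ⁅⁆-E : ∀ n (u : Fin n → Carrier) z →
    (∀ {i j} → i Fin.< j → u j * ⁅ z , u i ⁆ ≈ ⁅ z , u i ⁆ * u j) →
    (∀ i → ⁅ z , u i ⁆ * u i ≈ 0#) →
    ∀ d → ⁅ z , E n u (suc d) ⁆ ≈ ⁅ z , E n u 1 ⁆ * E n u d
  ⁅⁆-E n u z com rpt zero = sym (*-identityʳ _)
  ⁅⁆-E zero u z com rpt (suc d) = trans (⁅⁆-0 z) (sym (zeroʳ _))
  -- The Leibniz rule and induction produce three of the four terms of `(s + k) * (Y + m * Z)`. The
  -- fourth, `k * (m * Z)`, vanishes by `rpt`. Moving m past s is the bracket relation: all letters
  -- in s lie below m, and z acts as a letter above it.
  ⁅⁆-E (suc n) u z com rpt (suc d) = begin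
    ⁅ z , E n u′ (2 ℕ.+ d) + m * Y ⁆                          ≈⟨ trans (⁅⁆-distribʳ-+ z _ _) (+-congˡ (⁅⁆-leibniz z m Y)) ⟩
    ⁅ z , E n u′ (2 ℕ.+ d) ⁆ + (⁅ z , m ⁆ * Y + m * ⁅ z , Y ⁆) ≈⟨ +-cong (ih (suc d)) (+-congˡ (*-congˡ (ih d))) ⟩
    s * Y + (k * Y + m * (s * Z))                             ≈⟨ +-congˡ (+-congˡ lem) ⟩
    s * Y + (k * Y + s * (m * Z))                             ≈⟨ +-congˡ (+-comm _ _) ⟩
    s * Y + (s * (m * Z) + k * Y)                             ≈⟨ +-assoc _ _ _ ⟨
    (s * Y + s * (m * Z)) + k * Y                             ≈⟨ +-cong (sym (distribˡ s Y (m * Z))) (sym (+-identityʳ _)) ⟩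
    s * (Y + m * Z) + (k * Y + 0#)                            ≈⟨ +-congˡ (+-congˡ kill) ⟨
    s * (Y + m * Z) + (k * Y + k * (m * Z))                   ≈⟨ +-congˡ (distribˡ k Y (m * Z)) ⟨
    s * (Y + m * Z) + k * (Y + m * Z)                         ≈⟨ distribʳ _ s k ⟨
    (s + k) * (Y + m * Z)                                     ≈⟨ *-congʳ (⁅⁆-E₁-step n u z) ⟨
    ⁅ z , E (suc n) u 1 ⁆ * (Y + m * Z)                       ∎
    where
    u′ = u ∘ inject₁
    m = u (fromℕ n)
    Y = E n u′ (suc d)
    Z = E n u′ d
    s = ⁅ z , E n u′ 1 ⁆
    k = ⁅ z , m ⁆
    ih = ⁅⁆-E n u′ z (com ∘ inject₁-mono) (rpt ∘ inject₁)
    lem : m * (s * Z) ≈ s * (m * Z)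
    lem = trans (sym (*-assoc _ _ _)) (trans (*-congʳ (E₁-bracket-commutes n u′ z m (com ∘ inject₁<fromℕ))) (*-assoc _ _ _))
    kill : k * (m * Z) ≈ 0#
    kill = trans (sym (*-assoc _ _ _)) (trans (*-congʳ (rpt (fromℕ n))) (zeroˡ Z))

  module _ {n} {u : Fin n → Carrier} (kr : KR u) where

    bracket′ : ∀ {i j k} → i Fin.< j → j Fin.< k → u j * ⁅ u k , u i ⁆ ≈ ⁅ u k , u i ⁆ * u j
    bracket′ {i} {j} {k} i<j j<k = begin
      u j * ⁅ u k , u i ⁆     ≈⟨ *-congˡ flip-sign ⟩
      u j * - ⁅ u i , u k ⁆   ≈⟨ sym (-‿distribʳ-* _ _) ⟩
      - (u j * ⁅ u i , u k ⁆) ≈⟨ -‿cong (bracket kr i<j j<k) ⟩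
      - (⁅ u i , u k ⁆ * u j) ≈⟨ -‿distribˡ-* _ _ ⟩
      - ⁅ u i , u k ⁆ * u j   ≈⟨ *-congʳ (sym flip-sign) ⟩
      ⁅ u k , u i ⁆ * u j     ∎
      where
      flip-sign : ⁅ u k , u i ⁆ ≈ - ⁅ u i , u k ⁆
      flip-sign = +-inverseʳ-unique _ _ (⁅⁆-anti (u i) (u k))

    ⁅⁆-repeat : ∀ z i → ⁅ z , u i ⁆ * u i ≈ 0#
    ⁅⁆-repeat z i = begin
      (z * u i - u i * z) * u i         ≈⟨ [y-z]x≈yx-zx _ _ _ ⟩
      z * u i * u i - u i * z * u i     ≈⟨ +-cong (trans (*-assoc _ _ _) (trans (*-congˡ (square kr i)) (zeroʳ z)))
                                                  (-‿cong (trans (*-assoc _ _ _) (repeat kr i z))) ⟩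
      0# - 0#                           ≈⟨ -‿inverseʳ 0# ⟩
      0#                                ∎

  -- Induction on the largest letter m, with e_1 = s + m and e_{d+1} = X + m Y. The brackets of s
  -- with X and with Y vanish by induction, and the terms containing m twice vanish by repetition.
  -- `⁅⁆-E` with z = m turns `⁅ m , X ⁆` into `⁅ m , s ⁆ * Y`, which cancels the remaining
  -- `⁅ s , m ⁆ * Y`.
  E₁-central : ∀ n (u : Fin n → Carrier) → KR u → ∀ d → ⁅ E n u 1 , E n u d ⁆ ≈ 0#
  E₁-central n u kr zero = ⁅⁆-1 _
  E₁-central zero u kr (suc d) = ⁅⁆-0 _
  E₁-central (suc n) u kr (suc d) = begin
    ⁅ E (suc n) u 1 , X + m * Y ⁆                         ≈⟨ ⁅⁆-cong (E₁-step n u) refl ⟩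
    ⁅ s + m , X + m * Y ⁆                                 ≈⟨ ⁅⁆-distribˡ-+ _ s m ⟩
    ⁅ s , X + m * Y ⁆ + ⁅ m , X + m * Y ⁆                 ≈⟨ +-cong (trans (⁅⁆-distribʳ-+ s X _) (+-cong (E₁-central n u′ kr′ (suc d)) (⁅⁆-leibniz s m Y)))
                                                                    (trans (⁅⁆-distribʳ-+ m X _) (+-congˡ (⁅⁆-leibniz m m Y))) ⟩
    (0# + (⁅ s , m ⁆ * Y + m * ⁅ s , Y ⁆)) + (⁅ m , X ⁆ + (⁅ m , m ⁆ * Y + m * ⁅ m , Y ⁆))
                                                          ≈⟨ +-cong (trans (+-identityˡ _) (trans (+-congˡ (trans (*-congˡ (E₁-central n u′ kr′ d)) (zeroʳ m))) (+-identityʳ _)))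
                                                                    (trans (+-congˡ (trans (+-cong (trans (*-congʳ (⁅⁆-self m)) (zeroˡ Y)) kill) (+-identityʳ 0#))) (+-identityʳ _)) ⟩
    ⁅ s , m ⁆ * Y + ⁅ m , X ⁆                             ≈⟨ +-congˡ (⁅⁆-E n u′ m com (⁅⁆-repeat kr′ m) d) ⟩
    ⁅ s , m ⁆ * Y + ⁅ m , s ⁆ * Y                         ≈⟨ distribʳ Y _ _ ⟨
    (⁅ s , m ⁆ + ⁅ m , s ⁆) * Y                           ≈⟨ trans (*-congʳ (⁅⁆-anti s m)) (zeroˡ Y) ⟩
    0#                                                    ∎
    where
    u′ = u ∘ inject₁
    kr′ = KR-restrict kr
    m = u (fromℕ n)
    X = E n u′ (suc d)
    Y = E n u′ d
    s = E n u′ 1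
    com : ∀ {i j} → i Fin.< j → u′ j * ⁅ m , u′ i ⁆ ≈ ⁅ m , u′ i ⁆ * u′ j
    com i<j = bracket′ kr (inject₁-mono i<j) (inject₁<fromℕ _)
    kill : m * ⁅ m , Y ⁆ ≈ 0#
    kill = trans (x[y-z]≈xy-xz _ _ _) (trans (+-cong (trans (sym (*-assoc _ _ _)) (trans (*-congʳ (square kr (fromℕ n))) (zeroˡ Y)))
                                                     (-‿cong (repeat kr (fromℕ n) Y)))
                                             (-‿inverseʳ 0#))

  -- Unimodal words

  -- V u b m p sums the words  p = i₀ > ⋯ > i_b < ⋯ < i_{b+m}.
  V : ∀ {n} → (Fin n → Carrier) → ℕ → ℕ → Fin n → Carrier
  V u zero    zero    p = u p
  V u zero    (suc m) p = u p * ∑ (λ q → guard (p <ᵇ q) (V u 0 m q))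
  V u (suc b) m       p = u p * ∑ (λ q → guard (q <ᵇ p) (V u b m q))

  W : ∀ {n} → (Fin n → Carrier) → ℕ → ℕ → Carrier
  W u b m = ∑ (V u b m)

  inject₁-<ᵇ : ∀ {n} (i j : Fin n) → inject₁ i <ᵇ inject₁ j ≡ i <ᵇ j
  inject₁-<ᵇ i j with Fin.<-cmp i j
  ... | tri< i<j _ _ = ≡.trans (<⇒<ᵇ≡true (inject₁-mono i<j)) (≡.sym (<⇒<ᵇ≡true i<j))
  ... | tri≈ i≮j ≡.refl _ = ≡.trans (<ᵇ-irrefl _) (≡.sym (<ᵇ-irrefl _))
  ... | tri> i≮j _ j<i = ≡.trans (≮⇒<ᵇ≡false (ℕ.<⇒≯ (inject₁-mono j<i))) (≡.sym (≮⇒<ᵇ≡false i≮j))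

  <ᵇ-isStrictTotalOrder : ∀ {n} → IsStrictTotalOrder {A = Fin n} _≡_ (λ i j → i <ᵇ j ≡ true)
  <ᵇ-isStrictTotalOrder = record
    { isStrictPartialOrder = record
      { isEquivalence = ≡.isEquivalence
      ; irrefl = λ { ≡.refl eq → Fin.<-irrefl ≡.refl (<ᵇ≡true⇒< eq) }
      ; trans  = λ p q → <⇒<ᵇ≡true (Fin.<-trans (<ᵇ≡true⇒< p) (<ᵇ≡true⇒< q))
      ; <-resp-≈ = (λ { ≡.refl p → p }) , (λ { ≡.refl p → p })
      }
    ; compare = λ i j → cmp i j (Fin.<-cmp i j)
    }
    where
    cmp : ∀ {n} (i j : Fin n) → Tri (i Fin.< j) (i ≡ j) (j Fin.< i) →
          Tri (i <ᵇ j ≡ true) (i ≡ j) (j <ᵇ i ≡ true)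
    cmp i j (tri< a ¬b ¬c) = tri< (<⇒<ᵇ≡true a) ¬b (¬c ∘ <ᵇ≡true⇒<)
    cmp i j (tri≈ ¬a b ¬c) = tri≈ (¬a ∘ <ᵇ≡true⇒<) b (¬c ∘ <ᵇ≡true⇒<)
    cmp i j (tri> ¬a ¬b c) = tri> (¬a ∘ <ᵇ≡true⇒<) ¬b (<⇒<ᵇ≡true c)

  -- A decreasing word stays below its first letter, so a new largest letter adds no words. An
  -- increasing part could climb to the new letter, which is why the statement is confined to m = 0.
  V-inject₁ : ∀ {n} (u : Fin (suc n) → Carrier) d p → V u d 0 (inject₁ p) ≈ V (u ∘ inject₁) d 0 p
  V-inject₁ u zero p = refl
  V-inject₁ {n} u (suc d) p = *-congˡ (begin
    ∑ (λ q → guard (q <ᵇ inject₁ p) (V u d 0 q))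
      ≈⟨ ∑-init-last _ ⟩
    ∑ (λ q → guard (inject₁ q <ᵇ inject₁ p) (V u d 0 (inject₁ q))) + guard (fromℕ n <ᵇ inject₁ p) (V u d 0 (fromℕ n))
      ≈⟨ +-cong (∑-cong below) (reflexive (≡.cong (λ t → guard t (V u d 0 (fromℕ n))) top)) ⟩
    ∑ (λ q → guard (q <ᵇ p) (V (u ∘ inject₁) d 0 q)) + 0#
      ≈⟨ +-identityʳ _ ⟩
    ∑ (λ q → guard (q <ᵇ p) (V (u ∘ inject₁) d 0 q)) ∎)
    where
    top : fromℕ n <ᵇ inject₁ p ≡ false
    top = ≮⇒<ᵇ≡false (ℕ.<⇒≯ (inject₁<fromℕ p))
    below : ∀ q → guard (inject₁ q <ᵇ inject₁ p) (V u d 0 (inject₁ q)) ≈ guard (q <ᵇ p) (V (u ∘ inject₁) d 0 q)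
    below q rewrite inject₁-<ᵇ q p = guard-cong (q <ᵇ p) (V-inject₁ u d q)

  -- `E` splits words by whether they contain the largest letter, `V` by their first letter. In a
  -- decreasing word the largest letter can only come first, so the two agree on the summand at
  -- `fromℕ n`.
  E≈W : ∀ n (u : Fin n → Carrier) d → E n u (suc d) ≈ W u d 0
  E≈W zero u d = sym (∑-empty _)
  E≈W (suc n) u d = begin
    E n (u ∘ inject₁) (suc d) + u (fromℕ n) * E n (u ∘ inject₁) d   ≈⟨ +-cong (trans (E≈W n _ d) (∑-cong (λ p → sym (V-inject₁ u d p)))) (top d) ⟩
    ∑ (λ p → V u d 0 (inject₁ p)) + V u d 0 (fromℕ n)             ≈⟨ ∑-init-last (V u d 0) ⟨
    ∑ (V u d 0)                                                   ∎
    where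
    top : ∀ d → u (fromℕ n) * E n (u ∘ inject₁) d ≈ V u d 0 (fromℕ n)
    top zero    = *-identityʳ _
    top (suc d) = *-congˡ (begin
      E n (u ∘ inject₁) (suc d)                     ≈⟨ E≈W n _ d ⟩
      ∑ (V (u ∘ inject₁) d 0)                     ≈⟨ ∑-cong below ⟩
      ∑ (λ q → guard (inject₁ q <ᵇ fromℕ n) (V u d 0 (inject₁ q)))
                                                    ≈⟨ +-identityʳ _ ⟨
      ∑ (λ q → guard (inject₁ q <ᵇ fromℕ n) (V u d 0 (inject₁ q))) + 0#
                                                    ≈⟨ +-congˡ (reflexive (≡.cong (λ t → guard t (V u d 0 (fromℕ n))) (≡.sym (<ᵇ-irrefl (fromℕ n))))) ⟩
      ∑ (λ q → guard (inject₁ q <ᵇ fromℕ n) (V u d 0 (inject₁ q))) + guard (fromℕ n <ᵇ fromℕ n) (V u d 0 (fromℕ n))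
                                                    ≈⟨ ∑-init-last _ ⟨
      ∑ (λ q → guard (q <ᵇ fromℕ n) (V u d 0 q))  ∎)
      where
      below : ∀ q → V (u ∘ inject₁) d 0 q ≈ guard (inject₁ q <ᵇ fromℕ n) (V u d 0 (inject₁ q))
      below q rewrite <⇒<ᵇ≡true (inject₁<fromℕ q) = sym (V-inject₁ u d q)

  module _ {n} {u : Fin n → Carrier} (kr : KR u) where

    u*V-self : ∀ m p → u p * V u 0 m p ≈ 0#
    u*V-self zero    p = square kr p
    u*V-self (suc m) p = trans (sym (*-assoc _ _ _)) (trans (*-congʳ (square kr p)) (zeroˡ _))

    -- Only the junction matters: an ascent there leaves the valley at the last letter of the
    -- decreasing word, a descent moves it one place to the right, and equal letters give zero. The
    -- induction on b merely walks to the junction.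
    V*W : ∀ b m p → V u b 0 p * W u 0 m ≈ V u b (suc m) p + V u (suc b) m p
    V*W zero m p = begin
      u p * ∑ (V u 0 m)
        ≈⟨ *-∑ (u p) _ ⟩
      ∑ (λ q → u p * V u 0 m q)
        ≈⟨ ∑-cong split ⟩
      ∑ (λ q → u p * guard (p <ᵇ q) (V u 0 m q) + u p * guard (q <ᵇ p) (V u 0 m q))
        ≈⟨ ∑-+ _ _ ⟩
      ∑ (λ q → u p * guard (p <ᵇ q) (V u 0 m q)) + ∑ (λ q → u p * guard (q <ᵇ p) (V u 0 m q))
        ≈⟨ +-cong (*-∑ (u p) _) (*-∑ (u p) _) ⟨
      V u 0 (suc m) p + V u 1 m p ∎
      where
      split : ∀ q → u p * V u 0 m q ≈ u p * guard (p <ᵇ q) (V u 0 m q) + u p * guard (q <ᵇ p) (V u 0 m q)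
      split q with Fin.<-cmp p q
      ... | tri< p<q _ _ rewrite <⇒<ᵇ≡true p<q | ≮⇒<ᵇ≡false (ℕ.<⇒≯ p<q) = sym (trans (+-congˡ (zeroʳ _)) (+-identityʳ _))
      ... | tri> _ _ q<p rewrite <⇒<ᵇ≡true q<p | ≮⇒<ᵇ≡false (ℕ.<⇒≯ q<p) = sym (trans (+-congʳ (zeroʳ _)) (+-identityˡ _))
      ... | tri≈ _ ≡.refl _ rewrite <ᵇ-irrefl p = trans (u*V-self m p) (sym (trans (+-cong (zeroʳ _) (zeroʳ _)) (+-identityˡ _)))
    V*W (suc b) m p = begin
      u p * ∑ (λ q → guard (q <ᵇ p) (V u b 0 q)) * W u 0 m
        ≈⟨ *-assoc _ _ _ ⟩
      u p * (∑ (λ q → guard (q <ᵇ p) (V u b 0 q)) * W u 0 m)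
        ≈⟨ *-congˡ (trans (∑-* _ (W u 0 m)) (∑-cong step)) ⟩
      u p * ∑ (λ q → guard (q <ᵇ p) (V u b (suc m) q) + guard (q <ᵇ p) (V u (suc b) m q))
        ≈⟨ *-congˡ (∑-+ _ _) ⟩
      u p * (∑ (λ q → guard (q <ᵇ p) (V u b (suc m) q)) + ∑ (λ q → guard (q <ᵇ p) (V u (suc b) m q)))
        ≈⟨ distribˡ _ _ _ ⟩
      V u (suc b) (suc m) p + V u (suc (suc b)) m p ∎
      where
      step : ∀ q → guard (q <ᵇ p) (V u b 0 q) * W u 0 m ≈ guard (q <ᵇ p) (V u b (suc m) q) + guard (q <ᵇ p) (V u (suc b) m q)
      step q = trans (guard-* (q <ᵇ p) _ _) (trans (guard-cong (q <ᵇ p) (V*W b m q)) (guard-+ (q <ᵇ p) _ _))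

    W*W : ∀ b m → W u b 0 * W u 0 m ≈ W u b (suc m) + W u (suc b) m
    W*W b m = trans (∑-* _ (W u 0 m)) (trans (∑-cong (V*W b m)) (∑-+ _ _))

  -- Positive sums of monomials

  sumOver : ∀ {a} {A : Set a} → (A → Carrier) → List A → Carrier
  sumOver f = foldr (λ x s → f x + s) 0#

  monomial : ∀ {n} → (Fin n → Carrier) → List (Fin n) → Carrier
  monomial u = foldr (λ i x → u i * x) 1#

  sumOver-++ : ∀ {a} {A : Set a} (f : A → Carrier) xs ys → sumOver f (xs ++ ys) ≈ sumOver f xs + sumOver f ys
  sumOver-++ f []       ys = sym (+-identityˡ _)
  sumOver-++ f (x ∷ xs) ys = trans (+-congˡ (sumOver-++ f xs ys)) (sym (+-assoc _ _ _))

  sumOver-map : ∀ {a b} {A : Set a} {B : Set b} (f : B → Carrier) (g : A → B) xs → sumOver f (map g xs) ≡ sumOver (f ∘ g) xs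
  sumOver-map f g []       = ≡.refl
  sumOver-map f g (x ∷ xs) = ≡.cong (f (g x) +_) (sumOver-map f g xs)

  *-distribˡ-sumOver : ∀ {a} {A : Set a} x (f : A → Carrier) xs → x * sumOver f xs ≈ sumOver (λ y → x * f y) xs
  *-distribˡ-sumOver x f []       = zeroʳ x
  *-distribˡ-sumOver x f (y ∷ ys) = trans (distribˡ x _ _) (+-congˡ (*-distribˡ-sumOver x f ys))

  module _ {n} (u : Fin n → Carrier) where

    -- Coefficients are encoded as repetitions of a word in the list.
    Positive : Carrier → Set ℓ
    Positive z = Σ[ ws ∈ List (List (Fin n)) ] z ≈ sumOver (monomial u) ws

    pos-≈ : ∀ {x y} → x ≈ y → Positive y → Positive x
    pos-≈ x≈y (ws , eq) = ws , trans x≈y eq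

    pos-0 : Positive 0#
    pos-0 = [] , refl

    pos-+ : ∀ {x y} → Positive x → Positive y → Positive (x + y)
    pos-+ (xs , p) (ys , q) = xs ++ ys , trans (+-cong p q) (sym (sumOver-++ _ xs ys))

    pos-guard : ∀ b {x} → Positive x → Positive (guard b x)
    pos-guard true  p = p
    pos-guard false p = pos-0

    pos-∑ : ∀ {k} {f : Fin k → Carrier} → (∀ i → Positive (f i)) → Positive (∑ f)
    pos-∑ {zero}  p = pos-≈ (∑-empty _) pos-0
    pos-∑ {suc k} p = pos-≈ (∑-suc _) (pos-+ (p Fin.zero) (pos-∑ (p ∘ Fin.suc)))

    pos-* : ∀ i {x} → Positive x → Positive (u i * x)
    pos-* i (ws , eq) = map (i ∷_) ws ,
      trans (*-congˡ eq) (trans (*-distribˡ-sumOver (u i) _ ws) (reflexive (≡.sym (sumOver-map (monomial u) (i ∷_) ws))))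

    pos-u : ∀ i → Positive (u i)
    pos-u i = [ i ∷ [] ] , sym (trans (+-identityʳ _) (*-identityʳ (u i)))

    pos-V : ∀ b m p → Positive (V u b m p)
    pos-V zero    zero    p = pos-u p
    pos-V zero    (suc m) p = pos-* p (pos-∑ (λ q → pos-guard (p <ᵇ q) (pos-V 0 m q)))
    pos-V (suc b) m       p = pos-* p (pos-∑ (λ q → pos-guard (q <ᵇ p) (pos-V b m q)))

    pos-W : ∀ b m → Positive (W u b m)
    pos-W b m = pos-∑ (pos-V b m)

  E≈sumOver : ∀ n (u : Fin n → Carrier) d → sumOver (monomial u) (decWords n d) ≈ E n u d
  E≈sumOver zero    u zero    = +-identityʳ 1#
  E≈sumOver (suc n) u zero    = +-identityʳ 1#
  E≈sumOver zero    u (suc d) = refl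
  E≈sumOver (suc n) u (suc d) = begin
    sumOver (monomial u) (map (map inject₁) A ++ map (λ w → fromℕ n ∷ map inject₁ w) B)
      ≈⟨ sumOver-++ (monomial u) (map (map inject₁) A) _ ⟩
    sumOver (monomial u) (map (map inject₁) A) + sumOver (monomial u) (map (λ w → fromℕ n ∷ map inject₁ w) B)
      ≡⟨ ≡.cong₂ _+_ (sumOver-map _ _ A) (sumOver-map _ _ B) ⟩
    sumOver (monomial u ∘ map inject₁) A + sumOver (λ w → u (fromℕ n) * monomial u (map inject₁ w)) B
      ≈⟨ +-congˡ (sym (*-distribˡ-sumOver _ _ B)) ⟩
    sumOver (monomial u ∘ map inject₁) A + u (fromℕ n) * sumOver (monomial u ∘ map inject₁) B
      ≈⟨ +-cong (trans (sumOver-inject₁ A) (E≈sumOver n _ (suc d))) (*-congˡ (trans (sumOver-inject₁ B) (E≈sumOver n _ d))) ⟩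
    E n (u ∘ inject₁) (suc d) + u (fromℕ n) * E n (u ∘ inject₁) d ∎
    where
    A = decWords n (suc d)
    B = decWords n d
    monomial-inject₁ : ∀ w → monomial u (map inject₁ w) ≈ monomial (u ∘ inject₁) w
    monomial-inject₁ []      = refl
    monomial-inject₁ (i ∷ w) = *-congˡ (monomial-inject₁ w)
    sumOver-inject₁ : ∀ ws → sumOver (monomial u ∘ map inject₁) ws ≈ sumOver (monomial (u ∘ inject₁)) ws
    sumOver-inject₁ []       = refl
    sumOver-inject₁ (w ∷ ws) = +-cong (monomial-inject₁ w) (sumOver-inject₁ ws)

  -- Sums over triples of letters

  ∑³ : ∀ {n} → (Fin n → Fin n → Fin n → Carrier) → Carrier
  ∑³ f = ∑ λ p → ∑ λ q → ∑ λ r → f p q r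

  ∑³-cong : ∀ {n} {f g : Fin n → Fin n → Fin n → Carrier} → (∀ p q r → f p q r ≈ g p q r) → ∑³ f ≈ ∑³ g
  ∑³-cong f≈g = ∑-cong λ p → ∑-cong λ q → ∑-cong λ r → f≈g p q r

  ∑³-+ : ∀ {n} (f g : Fin n → Fin n → Fin n → Carrier) → ∑³ (λ p q r → f p q r + g p q r) ≈ ∑³ f + ∑³ g
  ∑³-+ f g = trans (∑-cong λ p → trans (∑-cong λ q → ∑-+ _ _) (∑-+ _ _)) (∑-+ _ _)

  ∑³-swap₁₂ : ∀ {n} (f : Fin n → Fin n → Fin n → Carrier) → ∑³ f ≈ ∑³ (λ p q r → f q p r)
  ∑³-swap₁₂ f = ∑-comm _

  ∑³-swap₂₃ : ∀ {n} (f : Fin n → Fin n → Fin n → Carrier) → ∑³ f ≈ ∑³ (λ p q r → f p r q)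
  ∑³-swap₂₃ f = ∑-cong λ p → ∑-comm _

  ∑³-swap₁₃ : ∀ {n} (f : Fin n → Fin n → Fin n → Carrier) → ∑³ f ≈ ∑³ (λ p q r → f r q p)
  ∑³-swap₁₃ f = trans (∑³-swap₁₂ f) (trans (∑³-swap₂₃ _) (∑³-swap₁₂ _))

  ∑³-+⁶ : ∀ {n} (f g h i j k : Fin n → Fin n → Fin n → Carrier) →
    ∑³ (λ p q r → f p q r + (g p q r + (h p q r + (i p q r + (j p q r + k p q r))))) ≈
    ∑³ f + (∑³ g + (∑³ h + (∑³ i + (∑³ j + ∑³ k))))
  ∑³-+⁶ f g h i j k = trans (∑³-+ f _) (+-congˡ (trans (∑³-+ g _) (+-congˡ (trans (∑³-+ h _) (+-congˡ
    (trans (∑³-+ i _) (+-congˡ (∑³-+ j k))))))))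

  guard-+⁶ : ∀ b u v w x y z →
    guard b (u + (v + (w + (x + (y + z))))) ≈ guard b u + (guard b v + (guard b w + (guard b x + (guard b y + guard b z))))
  guard-+⁶ true  u v w x y z = refl
  guard-+⁶ false u v w x y z = solve 0 (id ⊜ id ⊕ (id ⊕ (id ⊕ (id ⊕ (id ⊕ id))))) refl

  -- For triples with two equal letters: both sides vanish, whatever the guards evaluate to.
  guards-zero : ∀ a b c d e f {x} → x ≈ 0# →
    x ≈ guard a x + (guard b x + (guard c x + (guard d x + (guard e x + guard f x))))
  guards-zero a b c d e f {x} x≈0 = begin
    x                                      ≈⟨ x≈0 ⟩
    0#                                     ≈⟨ solve 0 (id ⊜ id ⊕ (id ⊕ (id ⊕ (id ⊕ (id ⊕ id))))) refl ⟩
    0# + (0# + (0# + (0# + (0# + 0#))))    ≈⟨ +-cong (z a) (+-cong (z b) (+-cong (z c) (+-cong (z d) (+-cong (z e) (z f))))) ⟩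
    _                                      ∎
    where
    z : ∀ b → 0# ≈ guard b x
    z b = sym (trans (guard-cong b x≈0) (guard-0 b))

  -- Triples of letters grouped by their underlying set, for an arbitrary strict total order

  module _ {n} (lt : Fin n → Fin n → Bool) (O : IsStrictTotalOrder _≡_ (λ i j → lt i j ≡ true)) where
    private module O = IsStrictTotalOrder O

    lt-false : ∀ {i j} → lt i j ≡ true → lt j i ≡ false
    lt-false i<j = ¬-not (O.asym i<j)

    chain : Fin n → Fin n → Fin n → Bool
    chain a b c = lt a b ∧ lt b c

    orders : (Fin n → Fin n → Fin n → Carrier) → Fin n → Fin n → Fin n → Carrier
    orders f a b c = f a b c + (f a c b + (f b a c + (f c a b + (f b c a + f c b a))))

    module _ (f : Fin n → Fin n → Fin n → Carrier)
             (f₁₂ : ∀ p r → f p p r ≈ 0#) (f₂₃ : ∀ p q → f p q q ≈ 0#) (f₁₃ : ∀ p q → f p q p ≈ 0#) where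

      by-order : Fin n → Fin n → Fin n → Carrier
      by-order p q r =
        guard (chain p q r) (f p q r) + (guard (chain p r q) (f p q r) + (guard (chain q p r) (f p q r) +
        (guard (chain q r p) (f p q r) + (guard (chain r p q) (f p q r) + guard (chain r q p) (f p q r)))))

      by-order-zero : ∀ p q r → f p q r ≈ 0# → f p q r ≈ by-order p q r
      by-order-zero p q r = guards-zero (chain p q r) (chain p r q) (chain q p r) (chain q r p) (chain r p q) (chain r q p)

      split-orders : ∀ p q r → f p q r ≈ by-order p q r
      split-orders p q r with O.compare p q | O.compare q r | O.compare p r
      ... | tri≈ _ ≡.refl _ | _ | _ = by-order-zero p p r (f₁₂ p r)
      ... | _ | tri≈ _ ≡.refl _ | _ = by-order-zero p q q (f₂₃ p q)
      ... | _ | _ | tri≈ _ ≡.refl _ = by-order-zero p q p (f₁₃ p q)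
      ... | tri< p<q _ _ | tri< q<r _ _ | _
        rewrite p<q | lt-false p<q | q<r | lt-false q<r | O.trans p<q q<r | lt-false (O.trans p<q q<r) =
        solve 1 (λ x → x ⊜ x ⊕ (id ⊕ (id ⊕ (id ⊕ (id ⊕ id))))) refl _
      ... | tri< p<q _ _ | tri> _ _ r<q | tri< p<r _ _
        rewrite p<q | lt-false p<q | r<q | lt-false r<q | p<r | lt-false p<r =
        solve 1 (λ x → x ⊜ id ⊕ (x ⊕ (id ⊕ (id ⊕ (id ⊕ id))))) refl _
      ... | tri< p<q _ _ | tri> _ _ r<q | tri> _ _ r<p
        rewrite p<q | lt-false p<q | r<q | lt-false r<q | r<p | lt-false r<p =
        solve 1 (λ x → x ⊜ id ⊕ (id ⊕ (id ⊕ (id ⊕ (x ⊕ id))))) refl _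
      ... | tri> _ _ q<p | tri< q<r _ _ | tri< p<r _ _
        rewrite q<p | lt-false q<p | q<r | lt-false q<r | p<r | lt-false p<r =
        solve 1 (λ x → x ⊜ id ⊕ (id ⊕ (x ⊕ (id ⊕ (id ⊕ id))))) refl _
      ... | tri> _ _ q<p | tri< q<r _ _ | tri> _ _ r<p
        rewrite q<p | lt-false q<p | q<r | lt-false q<r | r<p | lt-false r<p =
        solve 1 (λ x → x ⊜ id ⊕ (id ⊕ (id ⊕ (x ⊕ (id ⊕ id))))) refl _
      ... | tri> _ _ q<p | tri> _ _ r<q | _
        rewrite q<p | lt-false q<p | r<q | lt-false r<q | O.trans r<q q<p | lt-false (O.trans r<q q<p) =
        solve 1 (λ x → x ⊜ id ⊕ (id ⊕ (id ⊕ (id ⊕ (id ⊕ x))))) refl _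

      -- A triple of distinct letters satisfies exactly one of the six chains, and a triple with a
      -- coincidence contributes nothing by the hypotheses on f.
      ∑³-orders : ∑³ f ≈ ∑³ (λ a b c → guard (chain a b c) (orders f a b c))
      ∑³-orders = begin
        ∑³ f ≈⟨ ∑³-cong split-orders ⟩
        ∑³ by-order
          ≈⟨ ∑³-+⁶ _ _ _ _ _ _ ⟩
        -- In each summand the bound variables are renamed so that its guard becomes `chain a b c`;
        -- the two cyclic orders take two transpositions.
        _ ≈⟨ +-congˡ (+-cong (∑³-swap₂₃ _) (+-cong (∑³-swap₁₂ _) (+-cong (trans (∑³-swap₁₂ _) (∑³-swap₂₃ _))
               (+-cong (trans (∑³-swap₂₃ _) (∑³-swap₁₂ _)) (∑³-swap₁₃ _))))) ⟩
        _ ≈⟨ ∑³-+⁶ _ _ _ _ _ _ ⟨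
        ∑³ (λ a b c →
          guard (chain a b c) (f a b c) + (guard (chain a b c) (f a c b) + (guard (chain a b c) (f b a c) +
          (guard (chain a b c) (f c a b) + (guard (chain a b c) (f b c a) + guard (chain a b c) (f c b a))))))
          ≈⟨ ∑³-cong (λ a b c → guard-+⁶ (chain a b c) _ _ _ _ _ _) ⟨
        ∑³ (λ a b c → guard (chain a b c) (orders f a b c)) ∎

    -- For a ≺ b ≺ c the term T b a c occurs only on the right, and only when P b holds.  There
    -- the four-term relation trades it for T b c a + T a c b − T c a b, and since P is closed
    -- downwards everything that does not cancel is then on the left.
    module _ (P : Fin n → Bool) (P-down : ∀ {i j} → lt i j ≡ true → P j ≡ true → P i ≡ true)
             (T : Fin n → Fin n → Fin n → Carrier)
             (T₁₂ : ∀ p r → T p p r ≈ 0#) (T₂₃ : ∀ p q → T p q q ≈ 0#) (T₁₃ : ∀ p q → T p q p ≈ 0#)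
             (four-term : ∀ {a b c} → lt a b ≡ true → lt b c ≡ true → T b a c + T c a b ≈ T b c a + T a c b) where

      -- The two guards say where `P` ends. If it ends between b and c, the relation leaves T c a b;
      -- if it ends between a and b, only T a c b is present at all. When `P` holds for all three
      -- letters the relation balances both sides, and when it holds for none both are empty.
      excess : Fin n → Fin n → Fin n → Carrier
      excess a b c = guard (chain a b c) (guard (P b ∧ not (P c)) (T c a b) + guard (P a ∧ not (P b)) (T a c b))

      private
        F G : Fin n → Fin n → Fin n → Carrier
        F p q r = guard (P p) (guard (lt r q) (T p q r))
        G p q r = guard (P p) (guard (lt q p) (T p q r))

      orders-excess : ∀ a b c → guard (chain a b c) (orders F a b c) ≈ guard (chain a b c) (orders G a b c) + excess a b c
      orders-excess a b c with lt a b in a<b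
      ... | false = sym (+-identityˡ 0#)
      ... | true with lt b c in b<c
      ... | false = sym (+-identityˡ 0#)
      ... | true
        rewrite lt-false a<b | lt-false b<c | O.trans a<b b<c | lt-false (O.trans a<b b<c)
        with P a in Pa | P b in Pb | P c in Pc
      ... | false | true | _ = contradiction (≡.trans (≡.sym Pa) (P-down a<b Pb)) λ ()
      ... | _ | false | true = contradiction (≡.trans (≡.sym Pb) (P-down b<c Pc)) λ ()
      ... | false | false | false = solve 0 (id ⊕ (id ⊕ (id ⊕ (id ⊕ (id ⊕ id)))) ⊜ (id ⊕ (id ⊕ (id ⊕ (id ⊕ (id ⊕ id))))) ⊕ (id ⊕ id)) refl
      ... | true | false | false = solve 1 (λ x → id ⊕ (x ⊕ (id ⊕ (id ⊕ (id ⊕ id)))) ⊜ (id ⊕ (id ⊕ (id ⊕ (id ⊕ (id ⊕ id))))) ⊕ (id ⊕ x)) refl _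
      ... | true | true | false = begin
        0# + (T a c b + (0# + (0# + (T b c a + 0#)))) ≈⟨ solve 2 (λ x y → id ⊕ (x ⊕ (id ⊕ (id ⊕ (y ⊕ id)))) ⊜ y ⊕ x) refl _ _ ⟩
        T b c a + T a c b                             ≈⟨ four-term a<b b<c ⟨
        T b a c + T c a b                             ≈⟨ solve 2 (λ x y → x ⊕ y ⊜ (id ⊕ (id ⊕ (x ⊕ (id ⊕ (id ⊕ id))))) ⊕ (y ⊕ id)) refl _ _ ⟩
        _ ∎
      ... | true | true | true = begin
        0# + (T a c b + (0# + (0# + (T b c a + T c b a)))) ≈⟨ solve 3 (λ x y z → id ⊕ (x ⊕ (id ⊕ (id ⊕ (y ⊕ z)))) ⊜ (y ⊕ x) ⊕ z) refl _ _ _ ⟩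
        (T b c a + T a c b) + T c b a                      ≈⟨ +-congʳ (four-term a<b b<c) ⟨
        (T b a c + T c a b) + T c b a                      ≈⟨ solve 3 (λ x y z → (x ⊕ y) ⊕ z ⊜ (id ⊕ (id ⊕ (x ⊕ (y ⊕ (id ⊕ z))))) ⊕ (id ⊕ id)) refl _ _ _ ⟩
        _ ∎

      ∑³-excess : ∑³ F ≈ ∑³ G + ∑³ excess
      ∑³-excess = begin
        ∑³ F ≈⟨ ∑³-orders F (λ p r → guard² (P p) (lt r p) (T₁₂ p r)) (λ p q → guard² (P p) (lt q q) (T₂₃ p q)) (λ p q → guard² (P p) (lt p q) (T₁₃ p q)) ⟩
        ∑³ (λ a b c → guard (chain a b c) (orders F a b c)) ≈⟨ ∑³-cong orders-excess ⟩
        ∑³ (λ a b c → guard (chain a b c) (orders G a b c) + excess a b c) ≈⟨ ∑³-+ _ _ ⟩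
        ∑³ (λ a b c → guard (chain a b c) (orders G a b c)) + ∑³ excess
          ≈⟨ +-congʳ (∑³-orders G (λ p r → guard² (P p) (lt p p) (T₁₂ p r)) (λ p q → guard² (P p) (lt q p) (T₂₃ p q)) (λ p q → guard² (P p) (lt q p) (T₁₃ p q))) ⟨
        ∑³ G + ∑³ excess ∎
        where
        guard² : ∀ a b {x} → x ≈ 0# → guard a (guard b x) ≈ 0#
        guard² a b x≈0 = trans (guard-cong a (trans (guard-cong b x≈0) (guard-0 b))) (guard-0 a)

      pos-excess : ∀ {k} (u : Fin k → Carrier) → (∀ p q r → Positive u (T p q r)) → Positive u (∑³ excess)
      pos-excess u pos-T = pos-∑ u λ a → pos-∑ u λ b → pos-∑ u λ c →
        pos-guard u (chain a b c) (pos-+ u (pos-guard u (P b ∧ not (P c)) (pos-T c a b)) (pos-guard u (P a ∧ not (P b)) (pos-T a c b)))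

  ∑³-∑-comm : ∀ {m n} (f : Fin n → Fin n → Fin n → Fin m → Carrier) →
    ∑³ (λ p q r → ∑ (f p q r)) ≈ ∑ (λ s → ∑³ (λ p q r → f p q r s))
  ∑³-∑-comm f = trans (∑-cong λ p → trans (∑-cong λ q → ∑-comm _) (∑-comm _)) (∑-comm _)

  -- Turns the commutator relation into an equation between sums of monomials, in which terms can be
  -- traded without signs.
  -‿transpose : ∀ {x y z w} → x - y ≈ z - w → x + w ≈ y + z
  -‿transpose {x} {y} {z} {w} eq = begin
    x + w                 ≈⟨ +-congʳ (+-identityʳ x) ⟨
    x + 0# + w            ≈⟨ +-congʳ (+-congˡ (-‿inverseˡ y)) ⟨
    x + (- y + y) + w     ≈⟨ solve 4 (λ x y′ y w → (x ⊕ (y′ ⊕ y)) ⊕ w ⊜ (x ⊕ y′) ⊕ (y ⊕ w)) refl _ _ _ _ ⟩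
    (x - y) + (y + w)     ≈⟨ +-congʳ eq ⟩
    (z - w) + (y + w)     ≈⟨ solve 4 (λ z w′ y w → (z ⊕ w′) ⊕ (y ⊕ w) ⊜ (y ⊕ z) ⊕ (w′ ⊕ w)) refl _ _ _ _ ⟩
    (y + z) + (- w + w)   ≈⟨ trans (+-congˡ (-‿inverseˡ w)) (+-identityʳ _) ⟩
    y + z                 ∎

  -- The four-term relation and the two positive differences

  module _ {n} {u : Fin n → Carrier} (kr : KR u) where

    four-term : ∀ {i j k} → i Fin.< j → j Fin.< k →
      u j * (u i * u k) + u k * (u i * u j) ≈ u j * (u k * u i) + u i * (u k * u j)
    four-term {i} {j} {k} i<j j<k = -‿transpose (begin
      u j * (u i * u k) - u j * (u k * u i) ≈⟨ x[y-z]≈xy-xz _ _ _ ⟨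
      u j * ⁅ u i , u k ⁆                   ≈⟨ bracket kr i<j j<k ⟩
      ⁅ u i , u k ⁆ * u j                   ≈⟨ [y-z]x≈yx-zx _ _ _ ⟩
      u i * u k * u j - u k * u i * u j     ≈⟨ +-cong (*-assoc _ _ _) (-‿cong (*-assoc _ _ _)) ⟩
      u i * (u k * u j) - u k * (u i * u j) ∎)

    square-* : ∀ i x → u i * (u i * x) ≈ 0#
    square-* i x = trans (sym (*-assoc _ _ _)) (trans (*-congʳ (square kr i)) (zeroˡ x))

    repeat-* : ∀ i x y → u i * (x * (u i * y)) ≈ 0#
    repeat-* i x y = trans (sym (trans (*-congʳ (sym (*-assoc _ _ _))) (trans (*-assoc _ _ _) (*-assoc _ _ _))))
                           (trans (*-congʳ (repeat kr i x)) (zeroˡ y))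

    *-square : ∀ x i → x * (u i * u i) ≈ 0#
    *-square x i = trans (*-congˡ (square kr i)) (zeroʳ x)

    X : ℕ → (Fin n → Bool) → Carrier
    X b P = ∑ (λ p → guard (P p) (V u b 0 p))

    DownClosed : (Fin n → Bool) → Set
    DownClosed P = ∀ {i j} → i <ᵇ j ≡ true → P j ≡ true → P i ≡ true

    below-downClosed : ∀ p → DownClosed (_<ᵇ p)
    below-downClosed p = IsStrictTotalOrder.trans <ᵇ-isStrictTotalOrder

    -- Both products sum words p q r with `P p`; the first asks for a descent from q to r, the
    -- second for one from p to q. These are the summands `F` and `G` of `∑³-excess`.
    X-base : ∀ P → DownClosed P → Σ[ g ∈ Carrier ] Positive u g × X 0 P * W u 1 0 ≈ X 1 P * W u 0 0 + g
    X-base P P-down = _ , pos-excess _<ᵇ_ O P P-down T T₁₂ T₂₃ T₁₃ rel u pos-T , (begin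
      X 0 P * W u 1 0                                            ≈⟨ ∑-* _ _ ⟩
      ∑ (λ p → guard (P p) (u p) * W u 1 0)                      ≈⟨ ∑-cong lhs ⟩
      ∑³ (λ p q r → guard (P p) (guard (r <ᵇ q) (T p q r)))      ≈⟨ ∑³-excess _<ᵇ_ O P P-down T T₁₂ T₂₃ T₁₃ rel ⟩
      ∑³ (λ p q r → guard (P p) (guard (q <ᵇ p) (T p q r))) + _  ≈⟨ +-congʳ (∑-cong rhs) ⟨
      ∑ (λ p → guard (P p) (V u 1 0 p) * W u 0 0) + _            ≈⟨ +-congʳ (∑-* _ _) ⟨
      X 1 P * W u 0 0 + _ ∎)
      where
      O = <ᵇ-isStrictTotalOrder
      T : Fin n → Fin n → Fin n → Carrier
      T p q r = u p * (u q * u r)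
      T₁₂ : ∀ p r → T p p r ≈ 0#
      T₁₂ p r = square-* p (u r)
      T₂₃ : ∀ p q → T p q q ≈ 0#
      T₂₃ p q = *-square (u p) q
      T₁₃ : ∀ p q → T p q p ≈ 0#
      T₁₃ p q = repeat kr p (u q)
      rel : ∀ {a b c} → a <ᵇ b ≡ true → b <ᵇ c ≡ true → T b a c + T c a b ≈ T b c a + T a c b
      rel a<b b<c = four-term (<ᵇ≡true⇒< a<b) (<ᵇ≡true⇒< b<c)
      pos-T : ∀ p q r → Positive u (T p q r)
      pos-T p q r = pos-* u p (pos-* u q (pos-u u r))
      lhs : ∀ p → guard (P p) (u p) * W u 1 0 ≈ ∑ (λ q → ∑ (λ r → guard (P p) (guard (r <ᵇ q) (T p q r))))
      lhs p = begin
        guard (P p) (u p) * W u 1 0     ≈⟨ guard-* (P p) _ _ ⟩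
        guard (P p) (u p * W u 1 0)     ≈⟨ guard-cong (P p) (trans (*-∑ _ _) (∑-cong λ q →
                                             trans (*-congˡ (*-∑ _ _)) (trans (*-∑ _ _) (∑-cong λ r →
                                             trans (*-congˡ (*-guard (r <ᵇ q) _ _)) (*-guard (r <ᵇ q) _ _))))) ⟩
        guard (P p) (∑ (λ q → ∑ (λ r → guard (r <ᵇ q) (T p q r))))
                                        ≈⟨ trans (guard-∑ (P p) _) (∑-cong λ q → guard-∑ (P p) _) ⟩
        ∑ (λ q → ∑ (λ r → guard (P p) (guard (r <ᵇ q) (T p q r)))) ∎
      rhs : ∀ p → guard (P p) (V u 1 0 p) * W u 0 0 ≈ ∑ (λ q → ∑ (λ r → guard (P p) (guard (q <ᵇ p) (T p q r))))
      rhs p = begin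
        guard (P p) (V u 1 0 p) * W u 0 0       ≈⟨ guard-* (P p) _ _ ⟩
        guard (P p) (V u 1 0 p * W u 0 0)       ≈⟨ guard-cong (P p) (trans (*-assoc _ _ _) (trans (*-congˡ (∑-* _ _))
                                                     (trans (*-∑ _ _) (∑-cong λ q → trans (*-congˡ (guard-* (q <ᵇ p) _ _))
                                                     (trans (*-guard (q <ᵇ p) _ _) (trans (guard-cong (q <ᵇ p)
                                                       (trans (*-congˡ (*-∑ _ _)) (*-∑ _ _))) (guard-∑ (q <ᵇ p) _))))))) ⟩
        guard (P p) (∑ (λ q → ∑ (λ r → guard (q <ᵇ p) (T p q r))))
                                                ≈⟨ trans (guard-∑ (P p) _) (∑-cong λ q → guard-∑ (P p) _) ⟩
        ∑ (λ q → ∑ (λ r → guard (P p) (guard (q <ᵇ p) (T p q r)))) ∎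

    -- `P` is general for the sake of the induction: after the first letter p is split off, the rest
    -- of the decreasing word must start below p, and `_<ᵇ p` is again closed downwards. Putting p
    -- back in front preserves positivity.
    X-positive : ∀ b P → DownClosed P → Σ[ g ∈ Carrier ] Positive u g × X b P * W u 1 0 ≈ X (suc b) P * W u 0 0 + g
    X-positive zero    P P-down = X-base P P-down
    X-positive (suc b) P P-down =
      ∑ (λ p → guard (P p) (u p * proj₁ (ih p))) ,
      pos-∑ u (λ p → pos-guard u (P p) (pos-* u p (proj₁ (proj₂ (ih p))))) , (begin
      X (suc b) P * W u 1 0                                   ≈⟨ ∑-* _ _ ⟩
      ∑ (λ p → guard (P p) (V u (suc b) 0 p) * W u 1 0)       ≈⟨ ∑-cong step ⟩
      ∑ (λ p → guard (P p) (V u (2 ℕ.+ b) 0 p) * W u 0 0 + guard (P p) (u p * proj₁ (ih p)))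
                                                              ≈⟨ ∑-+ _ _ ⟩
      ∑ (λ p → guard (P p) (V u (2 ℕ.+ b) 0 p) * W u 0 0) + _ ≈⟨ +-congʳ (∑-* _ _) ⟨
      X (2 ℕ.+ b) P * W u 0 0 + _ ∎)
      where
      ih = λ p → X-positive b (_<ᵇ p) (below-downClosed p)
      step : ∀ p → guard (P p) (V u (suc b) 0 p) * W u 1 0 ≈ guard (P p) (V u (2 ℕ.+ b) 0 p) * W u 0 0 + guard (P p) (u p * proj₁ (ih p))
      step p = begin
        guard (P p) (V u (suc b) 0 p) * W u 1 0              ≈⟨ guard-* (P p) _ _ ⟩
        guard (P p) (u p * X b (_<ᵇ p) * W u 1 0)            ≈⟨ guard-cong (P p) (trans (*-assoc _ _ _) (trans (*-congˡ (proj₂ (proj₂ (ih p))))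
                                                                  (trans (distribˡ _ _ _) (+-congʳ (sym (*-assoc _ _ _)))))) ⟩
        guard (P p) (V u (2 ℕ.+ b) 0 p * W u 0 0 + u p * proj₁ (ih p))
                                                             ≈⟨ guard-+ (P p) _ _ ⟩
        guard (P p) (V u (2 ℕ.+ b) 0 p * W u 0 0) + guard (P p) (u p * proj₁ (ih p))
                                                             ≈⟨ +-congʳ (guard-* (P p) _ _) ⟨
        guard (P p) (V u (2 ℕ.+ b) 0 p) * W u 0 0 + guard (P p) (u p * proj₁ (ih p)) ∎

    columns-positive : ∀ b → Σ[ g ∈ Carrier ] Positive u g × W u b 0 * W u 1 0 ≈ W u (suc b) 0 * W u 0 0 + g
    columns-positive b = X-positive b (λ _ → true) (λ _ _ → ≡.refl)

    -- ∑³-excess is applied to the reversed order, with the words read from right to left.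
    rows-positive : ∀ m → Σ[ g ∈ Carrier ] Positive u g × W u 1 0 * W u 1 m ≈ W u 0 0 * W u 2 m + g
    rows-positive m =
      ∑ (λ s → ∑³ (excess lt O (s <ᵇ_) (up s) (T s) (T₁₂ s) (T₂₃ s) (T₁₃ s) (rel s))) ,
      pos-∑ u (λ s → pos-excess lt O (s <ᵇ_) (up s) (T s) (T₁₂ s) (T₂₃ s) (T₁₃ s) (rel s) u (pos-T s)) , (begin
      W u 1 0 * W u 1 m                                                           ≈⟨ lhs ⟩
      ∑³ (λ p q r → ∑ λ s → guard (s <ᵇ r) (guard (q <ᵇ p) (T s r q p)))          ≈⟨ ∑³-∑-comm _ ⟩
      -- Exchanging p and r puts the letter next to the tail first, where `∑³-excess` expects the
      -- letter tested by `P`.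
      ∑ (λ s → ∑³ (λ p q r → guard (s <ᵇ r) (guard (q <ᵇ p) (T s r q p))))        ≈⟨ ∑-cong (λ s → ∑³-swap₁₃ _) ⟩
      ∑ (λ s → ∑³ (λ p q r → guard (s <ᵇ p) (guard (q <ᵇ r) (T s p q r))))        ≈⟨ ∑-cong (λ s → ∑³-excess lt O (s <ᵇ_) (up s) (T s) (T₁₂ s) (T₂₃ s) (T₁₃ s) (rel s)) ⟩
      ∑ (λ s → ∑³ (λ p q r → guard (s <ᵇ p) (guard (p <ᵇ q) (T s p q r))) + _)    ≈⟨ ∑-+ _ _ ⟩
      ∑ (λ s → ∑³ (λ p q r → guard (s <ᵇ p) (guard (p <ᵇ q) (T s p q r)))) + _    ≈⟨ +-congʳ (∑-cong (λ s → ∑³-swap₁₃ _)) ⟩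
      ∑ (λ s → ∑³ (λ p q r → guard (s <ᵇ r) (guard (r <ᵇ q) (T s r q p)))) + _    ≈⟨ +-congʳ (∑³-∑-comm _) ⟨
      ∑³ (λ p q r → ∑ λ s → guard (s <ᵇ r) (guard (r <ᵇ q) (T s r q p))) + _      ≈⟨ +-congʳ rhs ⟨
      W u 0 0 * W u 2 m + _ ∎)
      where
      lt : Fin n → Fin n → Bool
      lt = flip _<ᵇ_
      O = Flip.isStrictTotalOrder <ᵇ-isStrictTotalOrder
      up : ∀ s {i j} → lt i j ≡ true → s <ᵇ j ≡ true → s <ᵇ i ≡ true
      up s j<i s<j = IsStrictTotalOrder.trans <ᵇ-isStrictTotalOrder s<j j<i
      y : Fin n → Carrier
      y = V u 0 m
      T : Fin n → Fin n → Fin n → Fin n → Carrier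
      T s p q r = u r * (u q * (u p * y s))
      T₁₂ : ∀ s p r → T s p p r ≈ 0#
      T₁₂ s p r = trans (*-congˡ (square-* p (y s))) (zeroʳ _)
      T₂₃ : ∀ s p q → T s p q q ≈ 0#
      T₂₃ s p q = square-* q _
      T₁₃ : ∀ s p q → T s p q p ≈ 0#
      T₁₃ s p q = repeat-* p (u q) (y s)
      rel : ∀ s {a b c} → lt a b ≡ true → lt b c ≡ true → T s b a c + T s c a b ≈ T s b c a + T s a c b
      rel s {a} {b} {c} b<a c<b = begin
        T s b a c + T s c a b                                 ≈⟨ +-cong (pack c a b) (pack b a c) ⟩
        u c * (u a * u b) * y s + u b * (u a * u c) * y s     ≈⟨ distribʳ _ _ _ ⟨
        -- Reversing both the words and the order of the letters only exchanges the two sides of the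
        -- four-term relation.
        (u c * (u a * u b) + u b * (u a * u c)) * y s         ≈⟨ *-congʳ (trans (+-comm _ _) (trans (sym (four-term (<ᵇ≡true⇒< c<b) (<ᵇ≡true⇒< b<a))) (+-comm _ _))) ⟩
        (u a * (u c * u b) + u b * (u c * u a)) * y s         ≈⟨ distribʳ _ _ _ ⟩
        u a * (u c * u b) * y s + u b * (u c * u a) * y s     ≈⟨ +-cong (pack a c b) (pack b c a) ⟨
        T s b c a + T s a c b                                 ∎
        where
        pack : ∀ i j k → u i * (u j * (u k * y s)) ≈ u i * (u j * u k) * y s
        pack i j k = trans (*-congˡ (sym (*-assoc _ _ _))) (sym (*-assoc _ _ _))
      pos-T : ∀ s p q r → Positive u (T s p q r)
      pos-T s p q r = pos-* u r (pos-* u q (pos-* u p (pos-V u 0 m s)))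
      expand : ∀ p q r → u p * (u q * (u r * ∑ (λ s → guard (s <ᵇ r) (y s)))) ≈ ∑ λ s → guard (s <ᵇ r) (T s r q p)
      expand p q r = trans (*-congˡ (*-congˡ (*-∑ _ _))) (trans (*-congˡ (*-∑ _ _)) (trans (*-∑ _ _) (∑-cong λ s →
          trans (*-congˡ (trans (*-congˡ (*-guard (s <ᵇ r) _ _)) (*-guard (s <ᵇ r) _ _))) (*-guard (s <ᵇ r) _ _))))
      lhs : W u 1 0 * W u 1 m ≈ ∑³ (λ p q r → ∑ λ s → guard (s <ᵇ r) (guard (q <ᵇ p) (T s r q p)))
      lhs = trans (∑-* _ _) (∑-cong λ p → trans (*-assoc _ _ _) (trans (*-congˡ (∑-* _ _)) (trans (*-∑ _ _) (∑-cong λ q → begin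
        u p * (guard (q <ᵇ p) (u q) * W u 1 m)
          ≈⟨ trans (*-congˡ (guard-* (q <ᵇ p) _ _)) (*-guard (q <ᵇ p) _ _) ⟩
        guard (q <ᵇ p) (u p * (u q * W u 1 m))
          ≈⟨ guard-cong (q <ᵇ p) (trans (*-congˡ (*-∑ _ _)) (trans (*-∑ _ _) (∑-cong λ r → expand p q r))) ⟩
        guard (q <ᵇ p) (∑ λ r → ∑ λ s → guard (s <ᵇ r) (T s r q p))
          ≈⟨ trans (guard-∑ (q <ᵇ p) _) (∑-cong λ r → trans (guard-∑ (q <ᵇ p) _) (∑-cong λ s → guard-comm (q <ᵇ p) (s <ᵇ r) _)) ⟩
        ∑ (λ r → ∑ λ s → guard (s <ᵇ r) (guard (q <ᵇ p) (T s r q p))) ∎))))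
      rhs : W u 0 0 * W u 2 m ≈ ∑³ (λ p q r → ∑ λ s → guard (s <ᵇ r) (guard (r <ᵇ q) (T s r q p)))
      rhs = trans (∑-* _ _) (∑-cong λ p → trans (*-∑ _ _) (∑-cong λ q →
        trans (*-congˡ (*-∑ _ _)) (trans (*-∑ _ _) (∑-cong λ r → begin
        u p * (u q * guard (r <ᵇ q) (u r * ∑ (λ s → guard (s <ᵇ r) (y s))))
          ≈⟨ trans (*-congˡ (*-guard (r <ᵇ q) _ _)) (*-guard (r <ᵇ q) _ _) ⟩
        guard (r <ᵇ q) (u p * (u q * (u r * ∑ (λ s → guard (s <ᵇ r) (y s)))))
          ≈⟨ guard-cong (r <ᵇ q) (expand p q r) ⟩
        guard (r <ᵇ q) (∑ λ s → guard (s <ᵇ r) (T s r q p))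
          ≈⟨ trans (guard-∑ (r <ᵇ q) _) (∑-cong λ s → guard-comm (r <ᵇ q) (s <ᵇ r) _) ⟩
        ∑ (λ s → guard (s <ᵇ r) (guard (r <ᵇ q) (T s r q p))) ∎))))

  -- Jacobi–Trudi determinants

  sumOver-cong : ∀ {a} {A : Set a} {f g : A → Carrier} → (∀ x → f x ≈ g x) → ∀ xs → sumOver f xs ≈ sumOver g xs
  sumOver-cong f≈g []       = refl
  sumOver-cong f≈g (x ∷ xs) = +-cong (f≈g x) (sumOver-cong f≈g xs)

  sumOver-cong-All : ∀ {a p} {A : Set a} {P : A → Set p} {f g : A → Carrier} → (∀ {x} → P x → f x ≈ g x) →
    ∀ {xs} → All P xs → sumOver f xs ≈ sumOver g xs
  sumOver-cong-All f≈g []         = refl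
  sumOver-cong-All f≈g (px ∷ pxs) = +-cong (f≈g px) (sumOver-cong-All f≈g pxs)

  sumOver-+ : ∀ {a} {A : Set a} (f g : A → Carrier) xs → sumOver (λ x → f x + g x) xs ≈ sumOver f xs + sumOver g xs
  sumOver-+ f g []       = sym (+-identityˡ 0#)
  sumOver-+ f g (x ∷ xs) = trans (+-congˡ (sumOver-+ f g xs)) (interchange _ _ _ _)

  sumOver-neg : ∀ {a} {A : Set a} (f : A → Carrier) xs → sumOver (λ x → - f x) xs ≈ - sumOver f xs
  sumOver-neg f []       = sym -0#≈0#
  sumOver-neg f (x ∷ xs) = trans (+-congˡ (sumOver-neg f xs)) (-‿+-comm _ _)

  sumOver-concatMap : ∀ {a b} {A : Set a} {B : Set b} (f : B → Carrier) (g : A → List B) xs →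
    sumOver f (concatMap g xs) ≈ sumOver (λ x → sumOver f (g x)) xs
  sumOver-concatMap f g []       = refl
  sumOver-concatMap f g (x ∷ xs) = trans (sumOver-++ f (g x) _) (+-congˡ (sumOver-concatMap f g xs))

  signed : ℕ → Carrier → Carrier
  signed zero    x = x
  signed (suc k) x = - signed k x

  signed-cong : ∀ k {x y} → x ≈ y → signed k x ≈ signed k y
  signed-cong zero    x≈y = x≈y
  signed-cong (suc k) x≈y = -‿cong (signed-cong k x≈y)

  signed-0 : ∀ k → signed k 0# ≈ 0#
  signed-0 zero    = refl
  signed-0 (suc k) = trans (-‿cong (signed-0 k)) -0#≈0#

  signed-* : ∀ k x y → signed k (x * y) ≈ x * signed k y
  signed-* zero    x y = refl
  signed-* (suc k) x y = trans (-‿cong (signed-* k x y)) (-‿distribʳ-* x _)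

  module Determinant (e : ℤ → Carrier) (e-zero : e 0ℤ ≈ 1#) (e-neg : ∀ k → e -[1+ k ] ≈ 0#) where

    rowProduct : ℕ → List ℕ → List ℕ → Carrier
    rowProduct i (l ∷ ls) (p ∷ ps) = e ((pos l ℤ.+ pos p) ℤ.- pos i) * rowProduct (suc i) ls ps
    rowProduct i []       _        = 1#
    rowProduct i (_ ∷ _)  []       = 1#

    rowProductWith : Carrier → List ℕ → List ℕ → Carrier
    rowProductWith x (l ∷ ls) (p ∷ ps) = e ((pos l ℤ.+ pos p) ℤ.- pos 0) * (x * rowProduct 1 ls ps)
    rowProductWith x []       _        = 1#
    rowProductWith x (_ ∷ _)  []       = 1#

    -- The factor x is inserted after the entry of the first row.
    detWith : Carrier → List ℕ → Carrier
    detWith x ls = sumOver (λ π → signed (inversions π) (rowProductWith x ls π)) (perms (upTo (length ls)))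

    -- When a row and a column are deleted, an entry below and to the right of them has both numbers
    -- lowered by one, and its index l + p - i does not change.
    shift-index : ∀ l p i → (pos l ℤ.+ pos (suc p)) ℤ.- pos (suc i) ≡ (pos l ℤ.+ pos p) ℤ.- pos i
    shift-index l p i = ≡.trans (ℤ.m-n≡m⊖n (l ℕ.+ suc p) (suc i))
      (≡.trans (≡.cong (ℤ._⊖ suc i) (ℕ.+-suc l p))
      (≡.trans (ℤ.[1+m]⊖[1+n]≡m⊖n (l ℕ.+ p) i) (≡.sym (ℤ.m-n≡m⊖n (l ℕ.+ p) i))))

    rowProduct-shift : ∀ i ls ps → rowProduct (suc i) ls (map suc ps) ≈ rowProduct i ls ps
    rowProduct-shift i []       ps       = refl
    rowProduct-shift i (l ∷ ls) []       = refl
    rowProduct-shift i (l ∷ ls) (p ∷ ps) = *-cong (reflexive (≡.cong e (shift-index l p i))) (rowProduct-shift (suc i) ls ps)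

    -- Below row 1 the first column of the determinant vanishes.
    rowProduct-insert : ∀ i m ρ → length ρ ℕ.< m →
      All (λ τ → rowProduct (2 ℕ.+ i) (replicate m 1) τ ≈ 0#) (insertions 0 ρ)
    rowProduct-insert i (suc m) []      _         = trans (*-congʳ (e-neg i)) (zeroˡ _) ∷ []
    rowProduct-insert i (suc m) (y ∷ ρ) (s≤s ρ<m) = trans (*-congʳ (e-neg i)) (zeroˡ _) ∷
      All.map⁺ (All.map (λ eq → trans (*-congˡ eq) (zeroʳ _)) (rowProduct-insert (suc i) m ρ ρ<m))

    -- Inversions and permutations under insertion of 0

    inversions-map-suc : ∀ ps → inversions (map suc ps) ≡ inversions ps
    inversions-map-suc []       = ≡.refl
    inversions-map-suc (p ∷ ps) = ≡.cong₂ ℕ._+_ (smaller ps) (inversions-map-suc ps)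
      where
      smaller : ∀ qs → length (filter (λ y → y ℕ.<? suc p) (map suc qs)) ≡ length (filter (λ y → y ℕ.<? p) qs)
      smaller []       = ≡.refl
      smaller (q ∷ qs) with q ℕ.<ᵇ p
      ... | true  = ≡.cong suc (smaller qs)
      ... | false = smaller qs

    inversions-0∷ : ∀ ps → inversions (0 ∷ ps) ≡ inversions ps
    inversions-0∷ ps = ≡.cong (ℕ._+ inversions ps) (none ps)
      where
      none : ∀ qs → length (filter (λ y → y ℕ.<? 0) qs) ≡ 0
      none []       = ≡.refl
      none (q ∷ qs) = none qs

    -- The source of the minus sign in the expansion: 0 in second place has exactly one larger entry
    -- before it.
    inversions-swap-0 : ∀ p ps → inversions (suc p ∷ 0 ∷ map suc ps) ≡ suc (inversions (p ∷ ps))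
    inversions-swap-0 p ps = ≡.cong suc (≡.trans (≡.cong (length (filter (λ y → y ℕ.<? suc p) (map suc ps)) ℕ.+_) (inversions-0∷ (map suc ps)))
                                                 (inversions-map-suc (p ∷ ps)))

    insertions-map : ∀ (f : ℕ → ℕ) x ps → insertions (f x) (map f ps) ≡ map (map f) (insertions x ps)
    insertions-map f x []       = ≡.refl
    insertions-map f x (p ∷ ps) = ≡.cong ((f x ∷ f p ∷ map f ps) ∷_) (≡.trans (≡.cong (map (f p ∷_)) (insertions-map f x ps))
      (≡.trans (≡.sym (List.map-∘ (insertions x ps))) (List.map-∘ (insertions x ps))))

    -- `perms` inserts the head of its list into permutations of the tail. Together with `upTo-suc`
    -- this presents the permutations of n + 1 columns as insertions of column 0 into shifted
    -- permutations of n columns.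
    perms-map : ∀ (f : ℕ → ℕ) xs → perms (map f xs) ≡ map (map f) (perms xs)
    perms-map f []       = ≡.refl
    perms-map f (x ∷ xs) = ≡.trans (≡.cong (concatMap (insertions (f x))) (perms-map f xs))
      (≡.trans (List.concatMap-map (insertions (f x)) (map f) (perms xs))
      (≡.trans (List.concatMap-cong (insertions-map f x) (perms xs))
               (≡.sym (List.map-concatMap (map f) (insertions x) (perms xs)))))

    insertions-length : ∀ x ps → All (λ π → length π ≡ suc (length ps)) (insertions x ps)
    insertions-length x []       = ≡.refl ∷ []
    insertions-length x (p ∷ ps) = ≡.refl ∷ All.map⁺ (All.map (≡.cong suc) (insertions-length x ps))

    perms-length : ∀ xs → All (λ π → length π ≡ length xs) (perms xs)
    perms-length []       = ≡.refl ∷ []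
    perms-length (x ∷ xs) = All.concat⁺ (All.map⁺ (All.map
      (λ {π} eq → All.map (λ eq′ → ≡.trans eq′ (≡.cong suc eq)) (insertions-length x π)) (perms-length xs)))

    upTo-suc : ∀ n → upTo (suc n) ≡ 0 ∷ map suc (upTo n)
    upTo-suc n = ≡.cong (0 ∷_) (≡.sym (List.map-upTo suc n))

    detWith-cong : ∀ {x y} → x ≈ y → ∀ ls → detWith x ls ≈ detWith y ls
    detWith-cong {x} {y} x≈y ls = sumOver-cong (λ π → signed-cong (inversions π) (step ls π)) (perms (upTo (length ls)))
      where
      step : ∀ ls π → rowProductWith x ls π ≈ rowProductWith y ls π
      step []       π       = refl
      step (l ∷ ls) []      = refl
      step (l ∷ ls) (p ∷ π) = *-congˡ (*-congʳ x≈y)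

    index-0 : ∀ l → (pos l ℤ.+ pos 0) ℤ.- pos 0 ≡ pos l
    index-0 l = ≡.trans (ℤ.+-identityʳ (pos (l ℕ.+ 0))) (≡.cong pos (ℕ.+-identityʳ l))

    detWith-[_] : ∀ l x → detWith x (l ∷ []) ≈ e (pos l) * x
    detWith-[ l ] x = trans (+-identityʳ _) (*-cong (reflexive (≡.cong e (index-0 l))) (*-identityʳ x))

    module _ (x : Carrier) (l₀ l₁ m : ℕ) where
      private
        ls : List ℕ
        ls = l₀ ∷ suc l₁ ∷ replicate m 1

        F : List ℕ → Carrier
        F π = signed (inversions π) (rowProductWith x ls π)

        first second : List ℕ → Carrier
        first  σ = signed (inversions σ) (rowProductWith 1# (suc l₁ ∷ replicate m 1) σ)
        second σ = signed (inversions σ) (rowProductWith (x * e (pos l₁)) (suc l₀ ∷ replicate m 1) σ)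

      -- Row 0 uses column 0. In all other rows the row and column numbers drop together, so the
      -- minor is again of the same kind, with x standing in front of it.
      insert-in-row-0 : ∀ s σ → F (0 ∷ suc s ∷ map suc σ) ≈ e (pos l₀) * (x * first (s ∷ σ))
      insert-in-row-0 s σ = begin
        F (0 ∷ map suc (s ∷ σ))
          ≡⟨ ≡.cong (λ k → signed k (rowProductWith x ls (0 ∷ map suc (s ∷ σ))))
               (≡.trans (inversions-0∷ (map suc (s ∷ σ))) (inversions-map-suc (s ∷ σ))) ⟩
        signed k (e ((pos l₀ ℤ.+ pos 0) ℤ.- pos 0) * (x * rowProduct 1 (suc l₁ ∷ replicate m 1) (map suc (s ∷ σ))))
          ≈⟨ signed-cong k (*-cong (reflexive (≡.cong e (index-0 l₀))) (*-congˡ (trans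
               (rowProduct-shift 0 (suc l₁ ∷ replicate m 1) (s ∷ σ)) (*-congˡ (sym (*-identityˡ _)))))) ⟩
        signed k (e (pos l₀) * (x * rowProductWith 1# (suc l₁ ∷ replicate m 1) (s ∷ σ)))
          ≈⟨ trans (signed-* k _ _) (*-congˡ (signed-* k _ _)) ⟩
        e (pos l₀) * (x * first (s ∷ σ)) ∎
        where k = inversions (s ∷ σ)

      -- Row 1 uses column 0. Its entry, of index l₁, stands right after x and joins it. Row 0 keeps
      -- its number while its column number drops by one, which raises l₀ to `suc l₀`.
      insert-in-row-1 : ∀ s σ → F (suc s ∷ 0 ∷ map suc σ) ≈ - second (s ∷ σ)
      insert-in-row-1 s σ = begin
        F (suc s ∷ 0 ∷ map suc σ)
          ≡⟨ ≡.cong (λ k → signed k (rowProductWith x ls (suc s ∷ 0 ∷ map suc σ))) (inversions-swap-0 s σ) ⟩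
        - signed k (e ((pos l₀ ℤ.+ pos (suc s)) ℤ.- pos 0) * (x * (e (pos (l₁ ℕ.+ 0)) * rowProduct 2 (replicate m 1) (map suc σ))))
          ≈⟨ -‿cong (signed-cong k (*-cong (reflexive (≡.cong (λ j → e (pos j ℤ.- pos 0)) (ℕ.+-suc l₀ s)))
               (trans (*-congˡ (*-cong (reflexive (≡.cong (e ∘ pos) (ℕ.+-identityʳ l₁))) (rowProduct-shift 1 (replicate m 1) σ)))
                      (sym (*-assoc _ _ _))))) ⟩
        - second (s ∷ σ) ∎
        where k = inversions (s ∷ σ)

      insert-0 : ∀ σ → length σ ≡ suc m →
        sumOver F (insertions 0 (map suc σ)) ≈ e (pos l₀) * (x * first σ) - second σ
      insert-0 (s ∷ σ) eq = +-cong (insert-in-row-0 s σ) (trans (below-row-0 σ (ℕ.suc-injective eq)) (insert-in-row-1 s σ))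
        where
        vanish : ∀ k τ → rowProduct 2 (replicate m 1) τ ≈ 0# → ∀ y z →
          signed k (rowProductWith x ls (y ∷ z ∷ τ)) ≈ 0#
        vanish k τ eq y z = trans (signed-cong k (trans (*-congˡ (trans (*-congˡ (trans (*-congˡ eq) (zeroʳ _))) (zeroʳ _))) (zeroʳ _))) (signed-0 k)
        sumOver-zero : ∀ {G : List ℕ → Carrier} {πs} → All (λ π → G π ≈ 0#) πs → sumOver G πs ≈ 0#
        sumOver-zero []         = refl
        sumOver-zero (eq ∷ eqs) = trans (+-cong eq (sumOver-zero eqs)) (+-identityˡ 0#)
        below-row-0 : ∀ σ → length σ ≡ m → sumOver F (map (suc s ∷_) (insertions 0 (map suc σ))) ≈ F (suc s ∷ 0 ∷ map suc σ)
        below-row-0 []      _      = +-identityʳ _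
        below-row-0 (y ∷ σ) len = trans (+-congˡ (sumOver-zero (All.map⁺ (All.map⁺ (All.map
          (λ {τ} eq → vanish (inversions (suc s ∷ suc y ∷ τ)) τ eq (suc s) (suc y))
          (rowProduct-insert 0 m (map suc σ) (ℕ.≤-reflexive (≡.trans (≡.cong suc (List.length-map suc σ)) len)))))))) (+-identityʳ _)

      -- Expansion along the first column, which has only two nonzero entries.
      detWith-expand : detWith x ls ≈
        e (pos l₀) * (x * detWith 1# (suc l₁ ∷ replicate m 1)) - detWith (x * e (pos l₁)) (suc l₀ ∷ replicate m 1)
      detWith-expand = begin
        sumOver F (perms (upTo (suc n)))
          ≡⟨ ≡.cong (λ xs → sumOver F (perms xs)) (upTo-suc n) ⟩
        sumOver F (concatMap (insertions 0) (perms (map suc (upTo n))))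
          ≈⟨ sumOver-concatMap F (insertions 0) (perms (map suc (upTo n))) ⟩
        sumOver (λ ρ → sumOver F (insertions 0 ρ)) (perms (map suc (upTo n)))
          ≡⟨ ≡.cong (sumOver (λ ρ → sumOver F (insertions 0 ρ))) (perms-map suc (upTo n)) ⟩
        sumOver (λ ρ → sumOver F (insertions 0 ρ)) (map (map suc) Π)
          ≡⟨ sumOver-map _ (map suc) Π ⟩
        sumOver (λ σ → sumOver F (insertions 0 (map suc σ))) Π
          ≈⟨ sumOver-cong-All (λ {σ} eq → insert-0 σ (≡.trans eq length-Π)) (perms-length (upTo n)) ⟩
        sumOver (λ σ → e (pos l₀) * (x * first σ) - second σ) Π
          ≈⟨ sumOver-+ (λ σ → e (pos l₀) * (x * first σ)) (λ σ → - second σ) Π ⟩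
        sumOver (λ σ → e (pos l₀) * (x * first σ)) Π + sumOver (λ σ → - second σ) Π
          ≈⟨ +-cong (trans (*-congˡ (*-distribˡ-sumOver x first Π)) (*-distribˡ-sumOver (e (pos l₀)) (λ σ → x * first σ) Π))
                    (sym (sumOver-neg second Π)) ⟨
        e (pos l₀) * (x * sumOver first Π) - sumOver second Π ∎
        where
        n = suc (length (replicate m 1))
        Π = perms (upTo n)
        length-Π : length (upTo n) ≡ suc m
        length-Π = ≡.trans (List.length-upTo n) (≡.cong suc (List.length-replicate m))

  -- The determinants of the three families of shapes

  module JacobiTrudi {n} {u : Fin n → Carrier} (kr : KR u) (e : ℤ → Carrier)
                     (e≈E : ∀ d → e (pos d) ≈ E n u d) (e-neg : ∀ k → e -[1+ k ] ≈ 0#) where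

    open Determinant e (e≈E 0) e-neg public

    e≈W : ∀ d → e (pos (suc d)) ≈ W u d 0
    e≈W d = trans (e≈E (suc d)) (E≈W n u d)

    -‿residue : ∀ {x y z} → x ≈ y + z → x - y ≈ z
    -‿residue {x} {y} {z} eq = trans (+-congʳ eq) (xyx⁻¹≈y y z)

    hook : ∀ l m → detWith 1# (suc l ∷ replicate m 1) ≈ W u l m
    hook l zero    = trans (detWith-[ suc l ] 1#) (trans (*-identityʳ _) (e≈W l))
    hook l (suc m) = begin
      detWith 1# (suc l ∷ 1 ∷ replicate m 1)
        ≈⟨ detWith-expand 1# (suc l) 0 m ⟩
      e (pos (suc l)) * (1# * detWith 1# (1 ∷ replicate m 1)) - detWith (1# * e 0ℤ) (suc (suc l) ∷ replicate m 1)
        ≈⟨ +-cong (*-cong (e≈W l) (trans (*-identityˡ _) (hook 0 m)))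
                  (-‿cong (trans (detWith-cong (trans (*-identityˡ _) (e≈E 0)) (suc (suc l) ∷ replicate m 1)) (hook (suc l) m))) ⟩
      W u l 0 * W u 0 m - W u (suc l) m
        ≈⟨ -‿residue (trans (W*W kr l m) (+-comm _ _)) ⟩
      W u l (suc m) ∎

    -- The second row has part 1, so its entry in column 0 is e_0 = 1 and the trapped factor remains
    -- x throughout the recursion; in the other term x passes a single `e`. The induction is for all
    -- l because the expansion raises l.
    detWith-central : ∀ x → (∀ d → e (pos d) * x ≈ x * e (pos d)) → ∀ l m →
      detWith x (l ∷ replicate m 1) ≈ x * detWith 1# (l ∷ replicate m 1)
    detWith-central x com l zero = trans (detWith-[ l ] x) (trans (com l) (*-congˡ (sym (trans (detWith-[ l ] 1#) (*-identityʳ _)))))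
    detWith-central x com l (suc m) = begin
      detWith x (l ∷ 1 ∷ replicate m 1)
        ≈⟨ detWith-expand x l 0 m ⟩
      e (pos l) * (x * D) - detWith (x * e 0ℤ) (suc l ∷ replicate m 1)
        ≈⟨ +-cong (trans (sym (*-assoc _ _ _)) (trans (*-congʳ (com l)) (*-assoc _ _ _)))
                  (-‿cong (trans (detWith-cong (trans (*-congˡ (e≈E 0)) (*-identityʳ x)) (suc l ∷ replicate m 1)) (detWith-central x com (suc l) m))) ⟩
      x * (e (pos l) * D) - x * detWith 1# (suc l ∷ replicate m 1)
        ≈⟨ x[y-z]≈xy-xz x _ _ ⟨
      x * (e (pos l) * D - detWith 1# (suc l ∷ replicate m 1))
        ≈⟨ *-congˡ (+-cong (*-congˡ (*-identityˡ D)) (-‿cong (detWith-cong (trans (*-identityˡ _) (e≈E 0)) (suc l ∷ replicate m 1)))) ⟨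
      x * (e (pos l) * (1# * D) - detWith (1# * e 0ℤ) (suc l ∷ replicate m 1))
        ≈⟨ *-congˡ (detWith-expand 1# l 0 m) ⟨
      x * detWith 1# (l ∷ 1 ∷ replicate m 1) ∎
      where D = detWith 1# (1 ∷ replicate m 1)

    e₁-central : ∀ d → e (pos d) * e (pos 1) ≈ e (pos 1) * e (pos d)
    e₁-central d = begin
      e (pos d) * e (pos 1)   ≈⟨ *-cong (e≈E d) (e≈E 1) ⟩
      E n u d * E n u 1       ≈⟨ ⁅⁆≈0⇒comm (E₁-central n u kr d) ⟨
      E n u 1 * E n u d       ≈⟨ *-cong (e≈E 1) (e≈E d) ⟨
      e (pos 1) * e (pos d)   ∎

    det-hook-positive : ∀ b m → Positive u (detWith 1# (suc b ∷ replicate m 1))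
    det-hook-positive b m = pos-≈ u (hook b m) (pos-W u b m)

    det-2-2-1ᵐ-positive : ∀ m → Positive u (detWith 1# (2 ∷ 2 ∷ replicate m 1))
    det-2-2-1ᵐ-positive m = pos-≈ u (begin
      detWith 1# (2 ∷ 2 ∷ replicate m 1)
        ≈⟨ detWith-expand 1# 2 1 m ⟩
      e (pos 2) * (1# * detWith 1# (2 ∷ replicate m 1)) - detWith (1# * e (pos 1)) (3 ∷ replicate m 1)
        -- The factor e_1 is trapped behind the first row of a hook determinant; once centrality has
        -- moved it to the front, that determinant is `W u 2 m`.
        ≈⟨ +-cong (*-cong (e≈W 1) (trans (*-identityˡ _) (hook 1 m)))
                  (-‿cong (trans (detWith-cong (*-identityˡ _) (3 ∷ replicate m 1)) (trans (detWith-central (e (pos 1)) e₁-central 3 m) (*-cong (e≈W 0) (hook 2 m))))) ⟩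
      W u 1 0 * W u 1 m - W u 0 0 * W u 2 m
        ≈⟨ -‿residue (proj₂ (proj₂ (rows-positive kr m))) ⟩
      proj₁ (rows-positive kr m) ∎) (proj₁ (proj₂ (rows-positive kr m)))

    det-2+b-2-positive : ∀ b → Positive u (detWith 1# (2 ℕ.+ b ∷ 2 ∷ []))
    det-2+b-2-positive b = pos-≈ u (begin
      detWith 1# (2 ℕ.+ b ∷ 2 ∷ [])
        ≈⟨ detWith-expand 1# (2 ℕ.+ b) 1 0 ⟩
      e (pos (2 ℕ.+ b)) * (1# * detWith 1# (2 ∷ [])) - detWith (1# * e (pos 1)) (3 ℕ.+ b ∷ [])
        -- A single row is left in the second term, so the factor e_1 already stands last, as
        -- `columns-positive` has it.
        ≈⟨ +-cong (*-cong (e≈W (suc b)) (trans (*-identityˡ _) (hook 1 0)))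
                  (-‿cong (trans (detWith-[ 3 ℕ.+ b ] _) (*-cong (e≈W (2 ℕ.+ b)) (trans (*-identityˡ _) (e≈W 0))))) ⟩
      W u (suc b) 0 * W u 1 0 - W u (2 ℕ.+ b) 0 * W u 0 0
        ≈⟨ -‿residue (proj₂ (proj₂ (columns-positive kr (suc b)))) ⟩
      proj₁ (columns-positive kr (suc b)) ∎) (proj₁ (proj₂ (columns-positive kr (suc b))))

-- Conjugates

firstPart-ones : ∀ b → firstPart (replicate b 1) ≤ 1
firstPart-ones zero    = z≤n
firstPart-ones (suc b) = ℕ.⊔-lub ℕ.≤-refl (firstPart-ones b)

columnLength : List ℕ → ℕ → ℕ
columnLength ls j = length (filter (λ x → suc j ℕ.≤? x) ls)

columnLength-ones-0 : ∀ b → columnLength (replicate b 1) 0 ≡ b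
columnLength-ones-0 zero    = ≡.refl
columnLength-ones-0 (suc b) = ≡.cong suc (columnLength-ones-0 b)

columnLength-ones-suc : ∀ b j → columnLength (replicate b 1) (suc j) ≡ 0
columnLength-ones-suc zero    j = ≡.refl
columnLength-ones-suc (suc b) j = columnLength-ones-suc b j

columnLength-∷ : ∀ {l j} ls → j ℕ.< l → columnLength (l ∷ ls) j ≡ suc (columnLength ls j)
columnLength-∷ {j = j} ls j<l = ≡.cong length (List.filter-accept (λ x → suc j ℕ.≤? x) j<l)

applyUpTo-const : ∀ {f : ℕ → ℕ} {c} n → (∀ {j} → j ℕ.< n → f j ≡ c) → applyUpTo f n ≡ replicate n c
applyUpTo-const zero    f≡c = ≡.refl
applyUpTo-const (suc n) f≡c = ≡.cong₂ _∷_ (f≡c (s≤s z≤n)) (applyUpTo-const n (f≡c ∘ s≤s))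

conj-applyUpTo : ∀ {n} ls → firstPart ls ≡ n → conj ls ≡ applyUpTo (columnLength ls) n
conj-applyUpTo {n} ls ≡.refl = List.map-upTo (columnLength ls) n

conj-hook : ∀ a b → conj (suc a ∷ replicate b 1) ≡ suc b ∷ replicate a 1
conj-hook a b = ≡.trans (conj-applyUpTo (suc a ∷ replicate b 1) (ℕ.m≥n⇒m⊔n≡m (ℕ.≤-trans (firstPart-ones b) (s≤s z≤n))))
  (≡.cong₂ _∷_ (≡.cong suc (columnLength-ones-0 b))
    (applyUpTo-const a λ {j} j<a → ≡.trans (columnLength-∷ (replicate b 1) (s≤s j<a)) (≡.cong suc (columnLength-ones-suc b j))))

-- Conjugation exchanges the families (a,2) and (2,2,1^a): the determinant with two rows belongs to
-- (2,2,1^a), the one with many rows to (a,2).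
conj-a-2 : ∀ a → conj (2 ℕ.+ a ∷ 2 ∷ []) ≡ 2 ∷ 2 ∷ replicate a 1
conj-a-2 a = ≡.trans (conj-applyUpTo (2 ℕ.+ a ∷ 2 ∷ []) (≡.cong (2 ℕ.+_) (ℕ.⊔-identityʳ a)))
  (≡.cong (λ ls → 2 ∷ 2 ∷ ls) (applyUpTo-const a λ j<a → columnLength-∷ (2 ∷ []) (s≤s (s≤s j<a))))

conj-2-2-1ᵃ : ∀ a → conj (2 ∷ 2 ∷ replicate a 1) ≡ 2 ℕ.+ a ∷ 2 ∷ []
conj-2-2-1ᵃ a = ≡.trans (conj-applyUpTo (2 ∷ 2 ∷ replicate a 1) (≡.cong (2 ℕ.⊔_) (ℕ.m≥n⇒m⊔n≡m (ℕ.m≤n⇒m≤1+n (firstPart-ones a)))))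
  (≡.cong₂ (λ x y → 2 ℕ.+ x ∷ 2 ℕ.+ y ∷ []) (columnLength-ones-0 a) (columnLength-ones-suc a 0))

-- The quotient ring U / I

module Quotient (N : ℕ) where
  open import Data.Integer using (_+_; _*_)
  open +-*-Solver using (solve; con; _:+_; _:*_; :-_; _:=_)

  private
    W : Set
    W = Word N

  -- The ℤ-linear extension of φ to U, evaluated at p. Since φ can be precomposed with
  -- concatenation, products become nested pairings.
  pair : Poly N → (W → ℤ) → ℤ
  pair []            φ = 0ℤ
  pair ((c , w) ∷ p) φ = c * φ w + pair p φ

  pair-cong : ∀ p {φ ψ} → (∀ w → φ w ≡ ψ w) → pair p φ ≡ pair p ψ
  pair-cong []            eq = ≡.refl
  pair-cong ((c , w) ∷ p) eq = ≡.cong₂ _+_ (≡.cong (c *_) (eq w)) (pair-cong p eq)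

  pair-++ : ∀ p q φ → pair (p ++ q) φ ≡ pair p φ + pair q φ
  pair-++ []            q φ = ≡.sym (ℤ.+-identityˡ _)
  pair-++ ((c , w) ∷ p) q φ = ≡.trans (≡.cong (c * φ w +_) (pair-++ p q φ)) (≡.sym (ℤ.+-assoc (c * φ w) _ _))

  *-linear : ∀ c d x y a b → c * (d * x + y) + (d * a + b) ≡ d * (c * x + a) + (c * y + b)
  *-linear = solve 6 (λ c d x y a b → c :* (d :* x :+ y) :+ (d :* a :+ b) := d :* (c :* x :+ a) :+ (c :* y :+ b)) ≡.refl

  pair-linear : ∀ p d φ ψ → pair p (λ w → d * φ w + ψ w) ≡ d * pair p φ + pair p ψ
  pair-linear []            d φ ψ = ≡.sym (≡.trans (ℤ.+-identityʳ _) (ℤ.*-zeroʳ d))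
  pair-linear ((c , w) ∷ p) d φ ψ = ≡.trans (≡.cong (c * (d * φ w + ψ w) +_) (pair-linear p d φ ψ))
    (*-linear c d (φ w) (ψ w) (pair p φ) (pair p ψ))

  pair-+ : ∀ p φ ψ → pair p (λ w → φ w + ψ w) ≡ pair p φ + pair p ψ
  pair-+ p φ ψ = ≡.trans (pair-cong p (λ w → ≡.cong (_+ ψ w) (≡.sym (ℤ.*-identityˡ (φ w)))))
    (≡.trans (pair-linear p 1ℤ φ ψ) (≡.cong (_+ pair p ψ) (ℤ.*-identityˡ (pair p φ))))

  pair-0 : ∀ p → pair p (λ _ → 0ℤ) ≡ 0ℤ
  pair-0 []            = ≡.refl
  pair-0 ((c , w) ∷ p) = ≡.cong₂ _+_ (ℤ.*-zeroʳ c) (pair-0 p)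

  pair-map : ∀ (f : ℤ × W → ℤ × W) c (g : W → W) → (∀ d w → f (d , w) ≡ (c * d , g w)) →
    ∀ p φ → pair (map f p) φ ≡ c * pair p (φ ∘ g)
  pair-map f c g eq []            φ = ≡.sym (ℤ.*-zeroʳ c)
  pair-map f c g eq ((d , w) ∷ p) φ rewrite eq d w =
    ≡.trans (≡.cong₂ _+_ (ℤ.*-assoc c d (φ (g w))) (pair-map f c g eq p φ)) (≡.sym (ℤ.*-distribˡ-+ c _ _))

  pair-scale : ∀ c p φ → pair (scale c p) φ ≡ c * pair p φ
  pair-scale c p φ = pair-map _ c (λ w → w) (λ _ _ → ≡.refl) p φ

  pair-* : ∀ p q φ → pair (p *U q) φ ≡ pair p (λ v → pair q (λ w → φ (v ++ w)))
  pair-* []            q φ = ≡.refl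
  pair-* ((c , v) ∷ p) q φ = ≡.trans (pair-++ (map _ q) (p *U q) φ)
    (≡.cong₂ _+_ (pair-map _ c (v ++_) (λ _ _ → ≡.refl) q φ) (pair-* p q φ))

  pair-mono : ∀ w φ → pair (mono w) φ ≡ φ w
  pair-mono w φ = ≡.trans (ℤ.+-identityʳ _) (ℤ.*-identityˡ (φ w))

  Combination : Set
  Combination = List (ℤ × W × Poly N × W)

  Valid : Combination → Set
  Valid = All (λ { (_ , _ , g , _) → KRGen g })

  pairᶜ : Combination → (W → ℤ) → ℤ
  pairᶜ []                    φ = 0ℤ
  pairᶜ ((c , x , g , y) ∷ l) φ = c * pair g (λ w → φ ((x ++ w) ++ y)) + pairᶜ l φ

  pair-combination : ∀ l φ → pair (combination l) φ ≡ pairᶜ l φ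
  pair-combination []                    φ = ≡.refl
  pair-combination ((c , x , g , y) ∷ l) φ = ≡.trans (pair-++ (scale c ((mono x *U g) *U mono y)) _ φ)
    (≡.cong₂ _+_ (≡.trans (pair-scale c ((mono x *U g) *U mono y) φ) (≡.cong (c *_)
      (≡.trans (pair-* (mono x *U g) (mono y) φ) (≡.trans (pair-* (mono x) g _) (≡.trans (pair-mono x (λ v → pair g (λ w → pair (mono y) (λ z → φ ((v ++ w) ++ z)))))
        (pair-cong g (λ w → pair-mono y (λ z → φ ((x ++ w) ++ z))))))))) (pair-combination l φ))

  pairᶜ-linear : ∀ l d φ ψ → pairᶜ l (λ w → d * φ w + ψ w) ≡ d * pairᶜ l φ + pairᶜ l ψ
  pairᶜ-linear []                    d φ ψ = ≡.sym (≡.trans (ℤ.+-identityʳ _) (ℤ.*-zeroʳ d))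
  pairᶜ-linear ((c , x , g , y) ∷ l) d φ ψ =
    ≡.trans (≡.cong₂ (λ a b → c * a + b) (pair-linear g d _ _) (pairᶜ-linear l d φ ψ)) (*-linear c d _ _ _ _)

  pairᶜ-++ : ∀ k l φ → pairᶜ (k ++ l) φ ≡ pairᶜ k φ + pairᶜ l φ
  pairᶜ-++ []                    l φ = ≡.sym (ℤ.+-identityˡ _)
  pairᶜ-++ ((c , x , g , y) ∷ k) l φ = ≡.trans (≡.cong (c * _ +_) (pairᶜ-++ k l φ)) (≡.sym (ℤ.+-assoc (c * _) _ _))

  act : ℤ → W → W → Combination → Combination
  act d v v′ = map (λ { (c , x , g , y) → (d * c , v ++ x , g , y ++ v′) })

  act-valid : ∀ d v v′ {l} → Valid l → Valid (act d v v′ l)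
  act-valid d v v′ valid = All.map⁺ (All.map (λ gen → gen) valid)

  pairᶜ-act : ∀ d v v′ l φ → pairᶜ (act d v v′ l) φ ≡ d * pairᶜ l (λ w → φ (v ++ (w ++ v′)))
  pairᶜ-act d v v′ []                    φ = ≡.sym (ℤ.*-zeroʳ d)
  pairᶜ-act d v v′ ((c , x , g , y) ∷ l) φ = ≡.trans
    (≡.cong₂ _+_ (≡.trans (ℤ.*-assoc d c _) (≡.cong (λ a → d * (c * a)) (pair-cong g (λ w → ≡.cong φ (assoc w)))))
                   (pairᶜ-act d v v′ l φ))
    (≡.sym (ℤ.*-distribˡ-+ d _ _))
    where
    assoc : ∀ w → ((v ++ x) ++ w) ++ (y ++ v′) ≡ v ++ (((x ++ w) ++ y) ++ v′)
    assoc w = ≡.trans (≡.cong (_++ (y ++ v′)) (List.++-assoc v x w))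
      (≡.trans (List.++-assoc v (x ++ w) (y ++ v′)) (≡.cong (v ++_) (≡.sym (List.++-assoc (x ++ w) y v′))))

  -- Closure of the ideal under multiplication from either side: every word of p is absorbed into
  -- the outer words of each summand.
  leftMul rightMul : Poly N → Combination → Combination
  leftMul  p l = concatMap (λ { (d , v) → act d v [] l }) p
  rightMul p l = concatMap (λ { (d , v) → act d [] v l }) p

  leftMul-valid : ∀ p {l} → Valid l → Valid (leftMul p l)
  leftMul-valid []            valid = []
  leftMul-valid ((d , v) ∷ p) valid = All.++⁺ (act-valid d v [] valid) (leftMul-valid p valid)

  rightMul-valid : ∀ p {l} → Valid l → Valid (rightMul p l)
  rightMul-valid []            valid = []
  rightMul-valid ((d , v) ∷ p) valid = All.++⁺ (act-valid d [] v valid) (rightMul-valid p valid)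

  pairᶜ-cong : ∀ l {φ ψ} → (∀ w → φ w ≡ ψ w) → pairᶜ l φ ≡ pairᶜ l ψ
  pairᶜ-cong []                    eq = ≡.refl
  pairᶜ-cong ((c , x , g , y) ∷ l) eq = ≡.cong₂ (λ a b → c * a + b) (pair-cong g (λ w → eq _)) (pairᶜ-cong l eq)

  pairᶜ-0 : ∀ l → pairᶜ l (λ _ → 0ℤ) ≡ 0ℤ
  pairᶜ-0 []                    = ≡.refl
  pairᶜ-0 ((c , x , g , y) ∷ l) = ≡.cong₂ _+_ (≡.trans (≡.cong (c *_) (pair-0 g)) (ℤ.*-zeroʳ c)) (pairᶜ-0 l)

  pairᶜ-leftMul : ∀ p l φ → pairᶜ (leftMul p l) φ ≡ pair p (λ v → pairᶜ l (λ w → φ (v ++ w)))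
  pairᶜ-leftMul []            l φ = ≡.refl
  pairᶜ-leftMul ((d , v) ∷ p) l φ = ≡.trans (pairᶜ-++ (act d v [] l) (leftMul p l) φ)
    (≡.cong₂ _+_ (≡.trans (pairᶜ-act d v [] l φ) (≡.cong (d *_) (pairᶜ-cong l (λ w → ≡.cong (λ z → φ (v ++ z)) (List.++-identityʳ w)))))
                   (pairᶜ-leftMul p l φ))

  -- The recursion is on p while the outer pairing runs over l, so linearity in φ serves to
  -- interchange the two sums.
  pairᶜ-rightMul : ∀ p l φ → pairᶜ (rightMul p l) φ ≡ pairᶜ l (λ v → pair p (λ w → φ (v ++ w)))
  pairᶜ-rightMul []            l φ = ≡.sym (pairᶜ-0 l)
  pairᶜ-rightMul ((d , v) ∷ p) l φ = ≡.trans (pairᶜ-++ (act d [] v l) (rightMul p l) φ)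
    (≡.trans (≡.cong₂ _+_ (pairᶜ-act d [] v l φ) (pairᶜ-rightMul p l φ))
             (≡.sym (pairᶜ-linear l d (λ w → φ (w ++ v)) (λ w → pair p (λ z → φ (w ++ z))))))

  infix 4 _∼_

  -- Testing against all functions on words makes the ring laws linear algebra over ℤ;
  -- φ = δ_w recovers the coefficients.
  record _∼_ (p q : Poly N) : Set where
    constructor by
    field
      difference : Combination
      valid      : Valid difference
      equation   : ∀ φ → pair p φ ≡ pair q φ + pairᶜ difference φ

  exact : ∀ {p q} → (∀ φ → pair p φ ≡ pair q φ) → p ∼ q
  exact eq = by [] [] λ φ → ≡.trans (eq φ) (≡.sym (ℤ.+-identityʳ _))

  ∼-refl : ∀ {p} → p ∼ p
  ∼-refl = exact (λ _ → ≡.refl)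

  ∼-sym : ∀ {p q} → p ∼ q → q ∼ p
  ∼-sym {p} {q} (by l valid eq) = by (act ℤ.-1ℤ [] [] l) (act-valid ℤ.-1ℤ [] [] valid) λ φ → ≡.sym (≡.trans
    (≡.cong₂ _+_ (eq φ) (≡.trans (pairᶜ-act ℤ.-1ℤ [] [] l φ) (≡.cong (ℤ.-1ℤ *_) (pairᶜ-cong l (λ w → ≡.cong φ (List.++-identityʳ w))))))
    (solve 2 (λ a b → (a :+ b) :+ con ℤ.-1ℤ :* b := a) ≡.refl (pair q φ) (pairᶜ l φ)))

  ∼-trans : ∀ {p q r} → p ∼ q → q ∼ r → p ∼ r
  ∼-trans {p} {q} {r} (by k k-valid eq) (by l l-valid eq′) = by (l ++ k) (All.++⁺ l-valid k-valid) λ φ →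
    ≡.trans (eq φ) (≡.trans (≡.cong (_+ pairᶜ k φ) (eq′ φ))
    (≡.trans (ℤ.+-assoc (pair r φ) _ _) (≡.cong (pair r φ +_) (≡.sym (pairᶜ-++ l k φ)))))

  +-cong : ∀ {p p′ q q′} → p ∼ p′ → q ∼ q′ → p +U q ∼ p′ +U q′
  +-cong {p} {p′} {q} {q′} (by k k-valid eq) (by l l-valid eq′) = by (k ++ l) (All.++⁺ k-valid l-valid) λ φ →
    ≡.trans (pair-++ p q φ) (≡.trans (≡.cong₂ _+_ (eq φ) (eq′ φ))
    (≡.trans (solve 4 (λ a b c d → (a :+ b) :+ (c :+ d) := (a :+ c) :+ (b :+ d)) ≡.refl (pair p′ φ) (pairᶜ k φ) (pair q′ φ) (pairᶜ l φ))
             (≡.sym (≡.cong₂ _+_ (pair-++ p′ q′ φ) (pairᶜ-++ k l φ)))))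

  neg : Poly N → Poly N
  neg = scale (ℤ.- 1ℤ)

  *-congʳ : ∀ p {q q′} → q ∼ q′ → p *U q ∼ p *U q′
  *-congʳ p {q} {q′} (by l valid eq) = by (leftMul p l) (leftMul-valid p valid) λ φ →
    ≡.trans (pair-* p q φ) (≡.trans (pair-cong p (λ v → eq _)) (≡.trans (pair-+ p _ _)
      (≡.sym (≡.cong₂ _+_ (pair-* p q′ φ) (pairᶜ-leftMul p l φ)))))

  *-congˡ : ∀ {p p′} q → p ∼ p′ → p *U q ∼ p′ *U q
  *-congˡ {p} {p′} q (by l valid eq) = by (rightMul q l) (rightMul-valid q valid) λ φ →
    ≡.trans (pair-* p q φ) (≡.trans (eq _) (≡.sym (≡.cong₂ _+_ (pair-* p′ q φ) (pairᶜ-rightMul q l φ))))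

  neg-cong : ∀ {p q} → p ∼ q → neg p ∼ neg q
  neg-cong {p} {q} (by l valid eq) = by (act ℤ.-1ℤ [] [] l) (act-valid ℤ.-1ℤ [] [] valid) λ φ →
    ≡.trans (pair-scale ℤ.-1ℤ p φ) (≡.trans (≡.cong (ℤ.-1ℤ *_) (eq φ)) (≡.trans (ℤ.*-distribˡ-+ ℤ.-1ℤ (pair q φ) (pairᶜ l φ))
      (≡.sym (≡.cong₂ _+_ (pair-scale ℤ.-1ℤ q φ)
        (≡.trans (pairᶜ-act ℤ.-1ℤ [] [] l φ) (≡.cong (ℤ.-1ℤ *_) (pairᶜ-cong l (λ w → ≡.cong φ (List.++-identityʳ w)))))))))

  *-assoc : ∀ p q r → (p *U q) *U r ∼ p *U (q *U r)
  *-assoc p q r = exact λ φ → ≡.trans (pair-* (p *U q) r φ) (≡.trans (pair-* p q _)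
    (≡.trans (pair-cong p (λ a → ≡.trans (pair-cong q (λ b → pair-cong r (λ c → ≡.cong φ (List.++-assoc a b c)))) (≡.sym (pair-* q r _))))
             (≡.sym (pair-* p (q *U r) φ))))

  neg-inverseʳ : ∀ p → p +U neg p ∼ zeroU
  neg-inverseʳ p = exact λ φ → ≡.trans (pair-++ p (neg p) φ) (≡.trans (≡.cong (pair p φ +_) (pair-scale ℤ.-1ℤ p φ))
    (solve 1 (λ a → a :+ con ℤ.-1ℤ :* a := con 0ℤ) ≡.refl (pair p φ)))

  +-comm : ∀ p q → p +U q ∼ q +U p
  +-comm p q = exact λ φ → ≡.trans (pair-++ p q φ) (≡.trans (ℤ.+-comm (pair p φ) (pair q φ)) (≡.sym (pair-++ q p φ)))

  ring : Ring _ _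
  ring = record
    { Carrier = Poly N
    ; _≈_ = _∼_
    ; _+_ = _+U_
    ; _*_ = _*U_
    ; -_ = neg
    ; 0# = zeroU
    ; 1# = oneU
    ; isRing = record
      { +-isAbelianGroup = record
        { isGroup = record
          { isMonoid = record
            { isSemigroup = record
              { isMagma = record
                { isEquivalence = record { refl = ∼-refl ; sym = ∼-sym ; trans = ∼-trans }
                ; ∙-cong = +-cong
                }
              ; assoc = λ p q r → exact λ φ → ≡.cong (λ s → pair s φ) (List.++-assoc p q r)
              }
            ; identity = (λ p → ∼-refl) , (λ p → exact λ φ → ≡.cong (λ s → pair s φ) (List.++-identityʳ p))
            }
          ; inverse = (λ p → ∼-trans (+-comm (neg p) p) (neg-inverseʳ p)) , neg-inverseʳ
          ; ⁻¹-cong = neg-cong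
          }
        ; comm = +-comm
        }
      ; *-cong = λ {p} {p′} {q} {q′} eq eq′ → ∼-trans (*-congˡ q eq) (*-congʳ p′ eq′)
      ; *-assoc = *-assoc
      ; *-identity = (λ p → exact λ φ → ≡.trans (pair-* oneU p φ) (pair-mono [] (λ v → pair p (λ w → φ (v ++ w)))))
                   , (λ p → exact λ φ → ≡.trans (pair-* p oneU φ)
                       (pair-cong p (λ v → ≡.trans (pair-mono [] (λ w → φ (v ++ w))) (≡.cong φ (List.++-identityʳ v)))))
      ; distrib = (λ p q r → exact λ φ → ≡.trans (pair-* p (q +U r) φ) (≡.trans (pair-cong p (λ v → pair-++ q r _))
                    (≡.trans (pair-+ p _ _) (≡.sym (≡.trans (pair-++ (p *U q) (p *U r) φ) (≡.cong₂ _+_ (pair-* p q φ) (pair-* p r φ)))))))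
                , (λ p q r → exact λ φ → ≡.trans (pair-* (q +U r) p φ) (≡.trans (pair-++ q r _)
                    (≡.sym (≡.trans (pair-++ (q *U p) (r *U p) φ) (≡.cong₂ _+_ (pair-* q p φ) (pair-* r p φ))))))
      }
    }

  -- The letters satisfy the relations in the quotient

  open Words ring using (KR; E; monomial; sumOver; signed; Positive; E≈sumOver; module JacobiTrudi)

  letter : Fin N → Poly N
  letter i = mono [ i ]

  letter-* : ∀ i p φ → pair (letter i *U p) φ ≡ pair p (λ w → φ (i ∷ w))
  letter-* i p φ = ≡.trans (pair-* (letter i) p φ) (pair-mono [ i ] (λ v → pair p (λ w → φ (v ++ w))))

  *-letter : ∀ p i φ → pair (p *U letter i) φ ≡ pair p (λ w → φ (w ++ [ i ]))
  *-letter p i φ = ≡.trans (pair-* p (letter i) φ) (pair-cong p (λ v → pair-mono [ i ] (λ w → φ (v ++ w))))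

  generator-difference : ∀ {p q g} → KRGen g → (∀ φ → pair p φ ≡ pair q φ + pair g φ) → p ∼ q
  generator-difference {p} {q} {g} gen eq = by ((1ℤ , [] , g , []) ∷ []) (gen ∷ []) λ φ → ≡.trans (eq φ)
    (≡.cong (pair q φ +_) (≡.sym (≡.trans (ℤ.+-identityʳ _) (≡.trans (ℤ.*-identityˡ _)
      (pair-cong g (λ w → ≡.cong φ (List.++-identityʳ w)))))))

  letter-bracket : ∀ {i j k} → i Fin.< j → j Fin.< k →
    letter j *U ((letter i *U letter k) -U (letter k *U letter i)) ∼ ((letter i *U letter k) -U (letter k *U letter i)) *U letter j
  -- The difference of the two sides is the generator itself; the last four terms given to the
  -- solver are its expansion, with signs +, -, -, +.
  letter-bracket {i} {j} {k} i<j j<k = generator-difference (comm i j k i<j j<k) λ φ →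
    solve 4 (λ a b c d →
      con 1ℤ :* a :+ (con ℤ.-1ℤ :* b :+ con 0ℤ) :=
      (con 1ℤ :* c :+ (con ℤ.-1ℤ :* d :+ con 0ℤ)) :+
      (con 1ℤ :* a :+ (con ℤ.-1ℤ :* b :+ (con ℤ.-1ℤ :* c :+ (con 1ℤ :* d :+ con 0ℤ)))))
      ≡.refl (φ (j ∷ i ∷ k ∷ [])) (φ (j ∷ k ∷ i ∷ [])) (φ (i ∷ k ∷ j ∷ [])) (φ (k ∷ i ∷ j ∷ []))

  ¬Unique-repeat : ∀ (i : Fin N) w → ¬ Unique (i ∷ (w ++ [ i ]))
  ¬Unique-repeat i w (i∉ ∷ _) with All.++⁻ʳ w i∉
  ... | i≢i ∷ [] = i≢i ≡.refl

  letter-repeat : ∀ i p → letter i *U (p *U letter i) ∼ zeroU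
  -- Each word w of p supplies its own generator, the word i w i, with the coefficient of w.
  letter-repeat i p = by (map (λ { (c , w) → c , [] , mono (i ∷ (w ++ [ i ])) , [] }) p) (valid p) λ φ →
    ≡.trans (letter-* i (p *U letter i) φ) (≡.trans (*-letter p i _) (≡.trans (eq φ p) (≡.sym (ℤ.+-identityˡ _))))
    where
    valid : ∀ p → Valid (map (λ { (c , w) → c , [] , mono (i ∷ (w ++ [ i ])) , [] }) p)
    valid []            = []
    valid ((c , w) ∷ p) = rep _ (¬Unique-repeat i w) ∷ valid p
    eq : ∀ φ p → pair p (λ w → φ (i ∷ (w ++ [ i ]))) ≡ pairᶜ (map (λ { (c , w) → c , [] , mono (i ∷ (w ++ [ i ])) , [] }) p) φ
    eq φ []            = ≡.refl
    eq φ ((c , w) ∷ p) = ≡.cong₂ (λ a b → c * a + b)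
      (≡.sym (≡.trans (pair-mono (i ∷ (w ++ [ i ])) (λ z → φ (z ++ []))) (≡.cong φ (List.++-identityʳ _)))) (eq φ p)

  letter-KR : KR letter
  letter-KR = record { bracket = letter-bracket ; repeat = letter-repeat }

  monomial-mono : ∀ w → monomial letter w ∼ mono w
  monomial-mono []      = ∼-refl
  monomial-mono (i ∷ w) = ∼-trans (*-congʳ (letter i) (monomial-mono w))
    (exact λ φ → ≡.trans (letter-* i (mono w) φ) (≡.trans (pair-mono w (λ v → φ (i ∷ v))) (≡.sym (pair-mono (i ∷ w) φ))))

  sumOver-monomial : ∀ ws → sumOver (monomial letter) ws ∼ map (1ℤ ,_) ws
  sumOver-monomial []       = ∼-refl
  sumOver-monomial (w ∷ ws) = +-cong (monomial-mono w) (sumOver-monomial ws)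

  e∼E : ∀ d → e N (pos d) ∼ E N letter d
  e∼E d = ∼-trans (∼-sym (sumOver-monomial (decWords N d))) (E≈sumOver N letter d)

  open JacobiTrudi letter-KR (e N) e∼E (λ _ → ∼-refl)

  -- Comparison of 𝔍 with the determinant, and transfer of positivity

  eProd≡rowProduct : ∀ i ls ps → eProd N i ls ps ≡ rowProduct i ls ps
  eProd≡rowProduct i []       ps       = ≡.refl
  eProd≡rowProduct i (l ∷ ls) []       = ≡.refl
  eProd≡rowProduct i (l ∷ ls) (p ∷ ps) = ≡.cong (e N ((pos l + pos p) ℤ.- pos i) *U_) (eProd≡rowProduct (suc i) ls ps)

  eProd∼rowProductWith : ∀ ls ps → eProd N 0 ls ps ∼ rowProductWith oneU ls ps
  eProd∼rowProductWith []       ps       = ∼-refl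
  eProd∼rowProductWith (l ∷ ls) []       = ∼-refl
  eProd∼rowProductWith (l ∷ ls) (p ∷ ps) rewrite eProd≡rowProduct 1 ls ps =
    *-congʳ (e N ((pos l + pos p) ℤ.- pos 0)) (∼-sym (Ring.*-identityˡ ring (rowProduct 1 ls ps)))

  scale-cong : ∀ k {p q} → p ∼ q → scale (sgnOf k) p ∼ signed k q
  scale-cong zero    {p} p∼q = ∼-trans (exact λ φ → ≡.trans (pair-scale 1ℤ p φ) (ℤ.*-identityˡ _)) p∼q
  scale-cong (suc k) {p} p∼q = ∼-trans (exact λ φ → ≡.trans (pair-scale (ℤ.- sgnOf k) p φ)
    (≡.trans (solve 2 (λ s a → (:- s) :* a := con ℤ.-1ℤ :* (s :* a)) ≡.refl (sgnOf k) (pair p φ))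
    (≡.sym (≡.trans (pair-scale ℤ.-1ℤ (scale (sgnOf k) p) φ) (≡.cong (ℤ.-1ℤ *_) (pair-scale (sgnOf k) p φ))))))
    (neg-cong (scale-cong k p∼q))

  sum-signed : ∀ ls πs →
    foldr _+U_ zeroU (map (λ π → scale (sgnOf (inversions π)) (eProd N 0 ls π)) πs) ∼
    sumOver (λ π → signed (inversions π) (rowProductWith oneU ls π)) πs
  sum-signed ls []       = ∼-refl
  sum-signed ls (π ∷ πs) = +-cong (scale-cong (inversions π) (eProd∼rowProductWith ls π)) (sum-signed ls πs)

  𝔍∼detWith : ∀ λ′ {ls} → conj λ′ ≡ ls → 𝔍 N λ′ ∼ detWith oneU ls
  𝔍∼detWith λ′ ≡.refl = sum-signed (conj λ′) (perms (upTo (length (conj λ′))))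

  δ : W → W → ℤ
  δ w v = if does (List.≡-dec Fin._≟_ v w) then 1ℤ else 0ℤ

  coeff≡pair : ∀ p w → coeff p w ≡ pair p (δ w)
  coeff≡pair []            w = ≡.refl
  coeff≡pair ((c , v) ∷ p) w = ≡.cong₂ _+_ (indicator (does (List.≡-dec Fin._≟_ v w))) (coeff≡pair p w)
    where
    indicator : ∀ b → (if b then c else 0ℤ) ≡ c * (if b then 1ℤ else 0ℤ)
    indicator true  = ≡.sym (ℤ.*-identityʳ c)
    indicator false = ≡.sym (ℤ.*-zeroʳ c)

  ∼⇒difference∈I : ∀ p q → p ∼ q → (p -U q) ∈I-KR
  ∼⇒difference∈I p q (by l valid eq) = l , valid , λ w → ≡.trans (coeff≡pair (p -U q) w)
    (≡.trans (pair-++ p (neg q) (δ w)) (≡.trans (≡.cong₂ _+_ (eq (δ w)) (pair-scale ℤ.-1ℤ q (δ w)))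
    (≡.trans (solve 2 (λ a b → (a :+ b) :+ con ℤ.-1ℤ :* a := b) ≡.refl (pair q (δ w)) (pairᶜ l (δ w)))
             (≡.sym (≡.trans (coeff≡pair (combination l) w) (pair-combination l (δ w)))))))

  Positive⇒PositiveModKR : ∀ p {q} → p ∼ q → Positive letter q → PositiveModKR p
  Positive⇒PositiveModKR p p∼q (ws , eq) = map (1 ,_) ws ,
    ∼⇒difference∈I p _ (∼-trans p∼q (∼-trans eq (∼-trans (sumOver-monomial ws)
      (exact λ φ → ≡.cong (λ s → pair s φ) (List.map-∘ ws)))))

  hook-positive : ∀ a b → PositiveModKR (𝔍 N (suc a ∷ replicate b 1))
  hook-positive a b = Positive⇒PositiveModKR (𝔍 N (suc a ∷ replicate b 1)) (𝔍∼detWith (suc a ∷ replicate b 1) (conj-hook a b)) (det-hook-positive b a)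

  a-2-positive : ∀ a → PositiveModKR (𝔍 N (2 ℕ.+ a ∷ 2 ∷ []))
  a-2-positive a = Positive⇒PositiveModKR (𝔍 N (2 ℕ.+ a ∷ 2 ∷ [])) (𝔍∼detWith (2 ℕ.+ a ∷ 2 ∷ []) (conj-a-2 a)) (det-2-2-1ᵐ-positive a)

  2-2-1ᵃ-positive : ∀ a → PositiveModKR (𝔍 N (2 ∷ 2 ∷ replicate a 1))
  2-2-1ᵃ-positive a = Positive⇒PositiveModKR (𝔍 N (2 ∷ 2 ∷ replicate a 1)) (𝔍∼detWith (2 ∷ 2 ∷ replicate a 1) (conj-2-2-1ᵃ a)) (det-2+b-2-positive a)

theorem1p3 : (N : ℕ) → 1 ≤ N →
    ((a b : ℕ) → 1 ≤ a → PositiveModKR (𝔍 N (a ∷ replicate b 1)))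
    × ((a : ℕ) → 2 ≤ a → PositiveModKR (𝔍 N (a ∷ 2 ∷ [])))
    × ((a : ℕ) → PositiveModKR (𝔍 N (2 ∷ 2 ∷ replicate a 1)))
theorem1p3 N _ =
  (λ { (suc a) b _ → hook-positive a b }) ,
  (λ { (suc (suc a)) _ → a-2-positive a ; (suc zero) (s≤s ()) }) ,
  2-2-1ᵃ-positive
  where open Quotient N
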